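{- Let $G=(V,E)$ be a finite simple undirected graph with degeneracy $d$, and let $0<\varepsilon\le 8$. Then DEC-ADG with parameter $\varepsilon$ produces a coloring of $G$ with at most $\lceil(2+\varepsilon)d\rceil$ colors.
   Context: A coloring is an assignment of colors to vertices such that no two neighboring vertices share the same color. For $U\subseteq V$, $G[U]$ is the subgraph induced on $U$ and $N_U(v)$ denotes the set of neighbors of $v$ in $U$. The degeneracy $d$ of $G$ is the smallest $s$ such that every (nonempty) induced subgraph of $G$ has a vertex of degree at most $s$. Algorithm ADG with accuracy $\eta$. Initialize $U=V$, $D[v]=\deg(v)$, $\ell=1$. While $U\ne\emptyset$: $\widehat\delta=\frac1{|U|}\sum_{v\in U}D[v]$; $R(\ell)=\{u\in U:D[u]\le(1+\eta)\widehat\delta\}$; for all $v\in R(\ell)$ and all $u\in N_U(v)$, decrement $D[u]$; $U=U\setminus R(\ell)$; set $\rho(v)=\ell$ for $v\in R(\ell)$; $\ell=\ell+1$. Let $\overline\rho$ be the number of iterations; $R(1),\dots,R(\overline\rho)$ partition $V$. Write $G(\ell)=G[R(\ell)]$. Algorithm DEC-ADG with parameter $\varepsilon$. Run ADG with accuracy $\eta=\varepsilon/12$. Put $\mu=\varepsilon/4$. Each vertex $v$ has a set $B_v$ of forbidden colors, initially empty. For $\ell=\overline\rho,\overline\rho-1,\dots,1$: let $Q=R(\overline\rho)\cup\dots\cup R(\ell+1)$ be the set of already colored vertices (empty for $\ell=\overline\rho$); for all $v\in R(\ell)$ and all $u\in N_Q(v)$ insert $C[u]$ into $B_v$; then run SIM-COL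 on $G(\ell)$ with the sets $B_v$, $v\in R(\ell)$. The array $C$ is the output coloring. SIM-COL on $G(\ell)$: let $\deg_\ell(v)=|N_{Q\cup R(\ell)}(v)|$ be the number of neighbors of $v$ in the partition being colored and in all already colored partitions. Set $U=R(\ell)$. While $U\ne\emptyset$: (1) in parallel, every $v\in U$ chooses a color $C[v]$ uniformly at random from $\{1,\dots,(1+\mu)\deg_\ell(v)\}$ (rounding of $(1+\mu)\deg_\ell(v)$ up to an integer is suppressed in the notation); (2) in parallel, every $v\in U$ for which some $u\in N_U(v)$ has chosen the same color, or for which $C[v]\in B_v$, has $C[v]$ reset to $0$; (3) for every $v\in U$ and $u\in N_U(v)$ with $C[u]>0$, insert $C[u]$ into $B_v$; then remove from $U$ all $v$ with $C[v]>0$.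
   Formalization: A vertex with deg_ℓ(v)=0 has an empty color range; it draws from {1,…,k₀}, k₀≤d, and completion (a finishing run always stays possible) is claimed only for k₀≥1, so not for edgeless graphs, where 0 colors fail. ε lies in any Archimedean ordered field with decidable order. -}

module Defs where

open import Algebra.Bundles using (CommutativeRing)
import Algebra.Properties.Semiring.Mult as Mult
open import Data.Bool.Base using (if_then_else_)
open import Data.Fin.Base using (Fin)
open import Data.Fin.Properties using (any?)
open import Data.Fin.Subset
  using (Subset; _∈_; _∉_; _∩_; _∪_; _─_; ⊤; ∣_∣; Nonempty; Empty)
  renaming (⊥ to ∅)
open import Data.Fin.Subset.Properties using (_∈?_)
open import Data.List.Base
  using (List; []; _∷_; _++_; map; filter; allFin; deduplicate; length; reverse)
import Data.List.Membership.DecPropositional as DecMembership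
open import Data.Nat.Base as ℕ using (ℕ; zero; suc)
open import Data.Nat.ListAction using (sum)
import Data.Nat.Properties as ℕ
open import Data.Product.Base using (_×_; _,_; proj₁; proj₂; ∃-syntax)
open import Data.Vec.Base using (tabulate)
open import Level using (_⊔_) renaming (suc to lsuc)
open import Relation.Binary.Core using (Rel)
open import Relation.Binary.Structures using (IsDecTotalOrder)
open import Relation.Binary.Construct.Closure.ReflexiveTransitive using (Star)
open import Relation.Binary.PropositionalEquality using (_≡_; _≢_)
open import Relation.Nullary using (¬_; yes; no; does; contradiction)
open import Relation.Nullary.Decidable using (_×-dec_; _⊎-dec_)
open import Relation.Unary using (Pred; Decidable)

leastWitness : ∀ {p} {P : Pred ℕ p} → Decidable P → ∀ n → P n →
               ∃[ m ] P m × (∀ k → P k → m ℕ.≤ k)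
leastWitness P? n pn with P? 0
leastWitness P? n       pn | yes p0 = 0 , p0 , λ _ _ → ℕ.z≤n
leastWitness P? zero    pn | no ¬p0 = contradiction pn ¬p0
leastWitness {P = P} P? (suc n) pn | no ¬p0
  with leastWitness {P = λ k → P (suc k)} (λ k → P? (suc k)) n pn
... | m , pm , min = suc m , pm , λ
  { zero    p0 → contradiction p0 ¬p0
  ; (suc k) pk → ℕ.s≤s (min k pk)
  }

-- The standard library has no real numbers.  The real parameter ε ranges over
-- an arbitrary Archimedean ordered field; ℝ, with its classical order, is one.
record ArchimedeanOrderedField c ℓ₁ ℓ₂ : Set (lsuc (c ⊔ ℓ₁ ⊔ ℓ₂)) where
  field
    commutativeRing : CommutativeRing c ℓ₁

  open CommutativeRing commutativeRing public
    using (Carrier; _≈_; _+_; _*_; -_; 0#; 1#; semiring)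
  open Mult semiring public using () renaming (_×_ to _·_)

  infix  4 _≤_ _<_
  infixl 7 _/_

  -- n · 1#, the image of n in the field.
  ⟦_⟧ : ℕ → Carrier
  ⟦ n ⟧ = n · 1#

  field
    _≤_             : Rel Carrier ℓ₂
    isDecTotalOrder : IsDecTotalOrder _≈_ _≤_
    +-monoˡ-≤       : ∀ z {x y} → x ≤ y → (x + z) ≤ (y + z)
    *-nonNegative   : ∀ {x y} → 0# ≤ x → 0# ≤ y → 0# ≤ (x * y)
    0≉1             : ¬ (0# ≈ 1#)
    -- Total for convenience; the value of 0# ⁻¹ is unspecified.
    _⁻¹             : Carrier → Carrier
    *-inverseʳ      : ∀ x → ¬ (x ≈ 0#) → (x * (x ⁻¹)) ≈ 1#
    archimedean     : ∀ x → ∃[ n ] x ≤ ⟦ n ⟧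

  open IsDecTotalOrder isDecTotalOrder public using (_≤?_)

  _<_ : Rel Carrier (ℓ₁ ⊔ ℓ₂)
  x < y = x ≤ y × ¬ (x ≈ y)

  _/_ : Carrier → Carrier → Carrier
  x / y = x * (y ⁻¹)

  ceiling : ∀ x → ∃[ n ] x ≤ ⟦ n ⟧ × (∀ m → x ≤ ⟦ m ⟧ → n ℕ.≤ m)
  ceiling x = leastWitness (λ n → x ≤? ⟦ n ⟧) (proj₁ (archimedean x)) (proj₂ (archimedean x))

  -- The least natural number above x: the usual ceiling whenever 0# ≤ x, and
  -- it is only applied to such x.
  ⌈_⌉ : Carrier → ℕ
  ⌈ x ⌉ = proj₁ (ceiling x)

-- A finite simple undirected graph on the vertices Fin n, given by its
-- neighbourhoods.
record Graph (n : ℕ) : Set where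
  field
    N        : Fin n → Subset n
    N-sym    : ∀ {u v} → u ∈ N v → v ∈ N u
    N-irrefl : ∀ {v} → v ∉ N v

subsetOf : ∀ {n p} {P : Pred (Fin n) p} → Decidable P → Subset n
subsetOf P? = tabulate (λ v → does (P? v))

elements : ∀ {n} → Subset n → List (Fin n)
elements U = filter (_∈? U) (allFin _)

module _ {n : ℕ} (G : Graph n) where
  open Graph G

  HasDegeneracyBound : ℕ → Set
  HasDegeneracyBound s = (W : Subset n) → Nonempty W → ∃[ v ] v ∈ W × ∣ N v ∩ W ∣ ℕ.≤ s

  IsDegeneracy : ℕ → Set
  IsDegeneracy d = HasDegeneracyBound d × (∀ s → HasDegeneracyBound s → d ℕ.≤ s)

  -- Colors are the positive integers; 0 marks an uncolored vertex.
  IsColoring : (Fin n → ℕ) → Set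
  IsColoring C = (∀ v → 1 ℕ.≤ C v) × (∀ {u v} → u ∈ N v → C u ≢ C v)

numColors : ∀ {n} → (Fin n → ℕ) → ℕ
numColors C = length (deduplicate ℕ._≟_ (map C (allFin _)))

module ADG {c ℓ₁ ℓ₂} (K : ArchimedeanOrderedField c ℓ₁ ℓ₂) {n : ℕ} (G : Graph n)
           (η : ArchimedeanOrderedField.Carrier K) where
  open ArchimedeanOrderedField K
  open Graph G

  δ̂ : Subset n → (Fin n → ℕ) → Carrier
  δ̂ U D = ⟦ sum (map D (elements U)) ⟧ / ⟦ ∣ U ∣ ⟧

  select : Subset n → (Fin n → ℕ) → Subset n
  select U D = subsetOf (λ u → (u ∈? U) ×-dec (⟦ D u ⟧ ≤? ((1# + η) * δ̂ U D)))

  -- D[u] is decremented once for every v ∈ R with u ∈ N_U(v).  The subtraction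
  -- does not truncate in a run, where D[u] = |N_U(u)| for u ∈ U.
  decrement : (U R : Subset n) → (Fin n → ℕ) → (Fin n → ℕ)
  decrement U R D u =
    D u ℕ.∸ ∣ subsetOf (λ v → (v ∈? R) ×-dec (u ∈? (N v ∩ U))) ∣

  -- Loop U D Rs: the while loop, entered with U and D, terminates after
  -- removing successively the parts listed in Rs.
  data Loop : Subset n → (Fin n → ℕ) → List (Subset n) → Set where
    stop : ∀ {U D} → Empty U → Loop U D []
    iter : ∀ {U D Rs} → Nonempty U →
           Loop (U ─ select U D) (decrement U (select U D) D) Rs →
           Loop U D (select U D ∷ Rs)

  -- Rs = R(1) , … , R(ρ̄); the numbering ρ is the position in this list.
  Run : List (Subset n) → Set
  Run = Loop ⊤ (λ v → ∣ N v ∣)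

-- Where deg_ℓ(v) = 0, the set {1,…,(1+μ)deg_ℓ(v)} that v draws its color from
-- is empty.  Such vertices draw from {1,…,k₀} here: k₀ = 0 is the literal
-- reading, in which they are never colored; k₀ = 1 gives them a single color.
module DecADG {c ℓ₁ ℓ₂} (K : ArchimedeanOrderedField c ℓ₁ ℓ₂) {n : ℕ} (G : Graph n)
              (ε : ArchimedeanOrderedField.Carrier K) (k₀ : ℕ) where
  open ArchimedeanOrderedField K
  open Graph G
  open DecMembership ℕ._≟_ using () renaming (_∈?_ to _∈ᴸ?_)

  η μ : Carrier
  η = ε / ⟦ 12 ⟧
  μ = ε / ⟦ 4 ⟧

  paletteSize : ℕ → ℕ
  paletteSize zero        = k₀
  paletteSize deg@(suc _) = ⌈ (1# + μ) * ⟦ deg ⟧ ⌉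

  record State : Set where
    constructor ⟨_,_,_,_,_,_⟩
    field
      pending : List (Subset n)     -- R(ℓ-1) , … , R(1)
      Q       : Subset n            -- R(ρ̄) ∪ … ∪ R(ℓ+1)
      R       : Subset n            -- R(ℓ)
      U       : Subset n            -- the vertices of R(ℓ) still to be colored
      C       : Fin n → ℕ
      B       : Fin n → List ℕ      -- the sets of forbidden colors

  degℓ : (Q R : Subset n) → Fin n → ℕ
  degℓ Q R v = ∣ N v ∩ (Q ∪ R) ∣

  insertColored : (Q R : Subset n) (C : Fin n → ℕ) → (Fin n → List ℕ) → (Fin n → List ℕ)
  insertColored Q R C B v =
    if does (v ∈? R) then map C (elements (N v ∩ Q)) ++ B v else B v

  -- Step (2): the colors after resetting, given the simultaneous choices c.
  resolve : (U : Subset n) (C : Fin n → ℕ) (B : Fin n → List ℕ) (c : Fin n → ℕ) → (Fin n → ℕ)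
  resolve U C B c v =
    if does (v ∈? U)
    then (if does (any? (λ u → (u ∈? (N v ∩ U)) ×-dec (c u ℕ.≟ c v)) ⊎-dec (c v ∈ᴸ? B v))
          then 0 else c v)
    else C v

  insertFresh : (U : Subset n) (C : Fin n → ℕ) → (Fin n → List ℕ) → (Fin n → List ℕ)
  insertFresh U C B v =
    if does (v ∈? U)
    then filter (0 ℕ.<?_) (map C (elements (N v ∩ U))) ++ B v
    else B v

  uncolored : (U : Subset n) (C : Fin n → ℕ) → Subset n
  uncolored U C = subsetOf (λ v → (v ∈? U) ×-dec (C v ℕ.≟ 0))

  -- One transition for every outcome of the random choices (each outcome
  -- that a round admits has positive probability).
  data _⟶_ : State → State → Set where
    -- SIM-COL has finished R(ℓ); it is started on R(ℓ-1) = R′.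
    advance : ∀ {R′ P Q R U C B} → Empty U →
              ⟨ R′ ∷ P , Q , R , U , C , B ⟩ ⟶
              ⟨ P , Q ∪ R , R′ , R′ , C , insertColored (Q ∪ R) R′ C B ⟩
    -- One iteration of the while loop of SIM-COL.
    round : ∀ {P Q R U C B} (c : Fin n → ℕ) → Nonempty U →
            (∀ v → v ∈ U → 1 ℕ.≤ c v × c v ℕ.≤ paletteSize (degℓ Q R v)) →
            let C′ = resolve U C B c in
            ⟨ P , Q , R , U , C , B ⟩ ⟶
            ⟨ P , Q , R , uncolored U C′ , C′ , insertFresh U C′ B ⟩

  _⟶*_ : State → State → Set
  _⟶*_ = Star _⟶_

  -- Before R(ρ̄) is started: Q, R(ℓ) and U are empty.
  initial : List (Subset n) → State
  initial Rs = ⟨ reverse Rs , ∅ , ∅ , ∅ , (λ _ → 0) , (λ _ → []) ⟩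

  Finished : State → Set
  Finished s = State.pending s ≡ [] × Empty (State.U s)

{-# OPTIONS --safe #-}
module Submission where

-- The parts that are colored before or together with R(ℓ) make up the vertex set U
-- that ADG has in its ℓ-th iteration, so deg_ℓ(v) is the degree of v in G[U].  The
-- average degree in G[U] is at most 2d, hence deg_ℓ(v) ≤ (1 + ε/12)2d for v ∈ R(ℓ)
-- and v draws its color from {1,…,m} with m ≤ ⌈(1 + ε/4)(1 + ε/12)2d⌉ ≤ ⌈(2 + ε)d⌉,
-- where the last step needs ε ≤ 8.  SIM-COL can always color another vertex,
-- because the palette of v has more than deg_ℓ(v) colors.

open import Algebra.Bundles using (CommutativeRing)
open import Algebra.Properties.CommutativeSemigroup using (interchange; x∙yz≈y∙xz)
import Algebra.Properties.Ring as RingProperties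
import Algebra.Properties.Semiring.Mult as Mult
import Algebra.Solver.Ring.NaturalCoefficients.Default as RingSolver
open import Data.Bool.Base using (true; false; if_then_else_)
open import Data.Fin.Base using (Fin; zero; suc)
open import Data.Fin.Properties using (_≟_; any?; injective⇒≤)
open import Data.Fin.Subset
  using (Subset; _∈_; _∉_; _⊆_; _∩_; _∪_; _─_; _-_; ⁅_⁆; ∣_∣; Nonempty)
  renaming (⊥ to ∅)
open import Data.Fin.Subset.Properties
  using (_∈?_; nonempty?; Empty-unique; ∉⊥; ∈⊤; ⊆-antisym; x∈⁅x⁆; x∈⁅y⁆⇒x≡y; ∣⁅x⁆∣≡1;
         x∈p∩q⁺; x∈p∩q⁻; ∩-identityʳ; x∈p∪q⁺; x∈p∪q⁻; p⊆p∪q; q⊆p∪q; ∪-identityˡ;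
         p─q⊆p; x∈p∧x∉q⇒x∈p─q; p∩q≢∅⇒∣p─q∣<∣p∣; x∈p∧x≢y⇒x∈p-y; x∈p⇒∣p-x∣<∣p∣;
         p⊆q⇒∣p∣≤∣q∣; p⊂q⇒∣p∣<∣q∣)
open import Data.List.Base
  using (List; []; _∷_; map; filter; allFin; length; lookup; foldl; reverse; applyUpTo)
open import Data.List.Properties using (map-tabulate; length-map; length-applyUpTo)
import Data.List.Membership.DecPropositional as DecMembership
open import Data.List.Membership.Propositional using () renaming (_∈_ to _∈ᴸ_; _∉_ to _∉ᴸ_)
open import Data.List.Membership.Propositional.Properties
  using (∈-lookup; ∈-map⁺; ∈-map⁻; ∈-filter⁺; ∈-filter⁻; ∈-++⁺ˡ; ∈-++⁺ʳ; ∈-++⁻; ∈-allFin;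
         ∈-applyUpTo⁺; ∈-applyUpTo⁻)
open import Data.List.Relation.Unary.All as All using (All)
import Data.List.Relation.Unary.All.Properties as All
open import Data.List.Relation.Unary.AllPairs using (_∷_)
open import Data.List.Relation.Unary.Any as Any using (here; there)
open import Data.List.Relation.Unary.Any.Properties using (lookup-index)
open import Data.List.Relation.Unary.Unique.DecPropositional.Properties using (deduplicate-!)
open import Data.List.Relation.Unary.Unique.Propositional using (Unique)
import Data.List.Relation.Unary.Unique.Propositional.Properties as Unique
open import Data.Nat.Base as ℕ using (ℕ; zero; suc; z≤n; s≤s)
open import Data.Nat.Induction using (<-wellFounded; Acc; acc)
open import Data.Nat.ListAction using (sum)
import Data.Nat.Properties as ℕ
open import Data.Nat.Solver using (module +-*-Solver)
open import Data.Product.Base using (_×_; _,_; proj₁; proj₂; ∃-syntax)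
open import Data.Sum.Base using (_⊎_; inj₁; inj₂; [_,_])
open import Data.Vec.Base using ([]; _∷_; here; there)
open import Data.Vec.Properties using (lookup∘tabulate; []=⇒lookup; lookup⇒[]=)
open import Function.Base using (_∘_; id; const; flip; case_of_)
open import Level using (Level)
open import Relation.Binary.Bundles using (Poset)
open import Relation.Binary.Construct.Closure.ReflexiveTransitive using (_◅_) renaming (ε to ε*)
open import Relation.Binary.PropositionalEquality
  using (_≡_; _≢_; refl; sym; trans; cong; cong₂; subst; module ≡-Reasoning)
import Relation.Binary.Reasoning.PartialOrder as PosetReasoning
open import Relation.Binary.Structures using (IsDecTotalOrder)
open import Relation.Nullary using (Dec; ¬_; yes; no; does; contradiction)
open import Relation.Nullary.Decidable using (_×-dec_; _⊎-dec_; dec-true; dec-false; toSum)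
open import Relation.Unary using (Pred; Decidable)
open import Defs

-- ADG peels parts off V downwards, whereas DEC-ADG builds up from the empty set, in the opposite
-- order. `Schedule` is the interface between the two: it keeps of an ADG run only what the coloring
-- uses, namely disjointness, exhaustion and the palette bound, and it is assembled from its last
-- part backwards while the ADG loop is traversed. The coloring argument is an invariant of single
-- transitions. Random choices appear as nondeterminism: properness and the bound are proved for all
-- outcomes, and termination becomes the existence of a finishing continuation from every reachable
-- state. Vertices with deg_ℓ(v) = 0 need their own treatment, since (1 + μ)deg_ℓ(v) = 0 offers no
-- color. They draw from {1,...,k₀}, and k₀ ≤ d keeps this within the bound; in an edgeless graph d
-- = 0 and the bound is 0, so even one color would be too many.

private
  variable
    a p q r : Level
    A : Set a
    n : ℕ

-- Membership in decidable subsets and in their enumerations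

∈-subsetOf⁺ : ∀ {P : Pred (Fin n) p} (P? : Decidable P) {v} → P v → v ∈ subsetOf P?
∈-subsetOf⁺ P? {v} pv =
  lookup⇒[]= v _ (trans (lookup∘tabulate (does ∘ P?) v) (dec-true (P? v) pv))

∈-subsetOf⁻ : ∀ {P : Pred (Fin n) p} (P? : Decidable P) {v} → v ∈ subsetOf P? → P v
∈-subsetOf⁻ P? {v} v∈ with P? v | trans (sym (lookup∘tabulate (does ∘ P?) v)) ([]=⇒lookup v∈)
... | yes pv | _ = pv

∈-elements⁺ : ∀ {U : Subset n} {v} → v ∈ U → v ∈ᴸ elements U
∈-elements⁺ {U = U} {v} v∈U = ∈-filter⁺ (_∈? U) (∈-allFin v) v∈U

∈-elements⁻ : ∀ {U : Subset n} {v} → v ∈ᴸ elements U → v ∈ U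
∈-elements⁻ {U = U} v∈ = proj₂ (∈-filter⁻ (_∈? U) {xs = allFin _} v∈)

∈-─⁻ : ∀ (U W : Subset n) {v} → v ∈ U ─ W → v ∉ W
∈-─⁻ (_ ∷ U) (_ ∷ W)     {suc v} (there v∈) (there v∈W) = ∈-─⁻ U W v∈ v∈W
∈-─⁻ (_ ∷ U) (true ∷ W)  {zero}  ()
∈-─⁻ (_ ∷ U) (false ∷ W) {zero}  _ ()

∣─∣+∣∩∣ : ∀ (U W : Subset n) → ∣ U ─ W ∣ ℕ.+ ∣ U ∩ W ∣ ≡ ∣ U ∣
∣─∣+∣∩∣ []          []          = refl
∣─∣+∣∩∣ (true ∷ U)  (true ∷ W)  = trans (ℕ.+-suc _ _) (cong suc (∣─∣+∣∩∣ U W))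
∣─∣+∣∩∣ (true ∷ U)  (false ∷ W) = cong suc (∣─∣+∣∩∣ U W)
∣─∣+∣∩∣ (false ∷ U) (true ∷ W)  = ∣─∣+∣∩∣ U W
∣─∣+∣∩∣ (false ∷ U) (false ∷ W) = ∣─∣+∣∩∣ U W

-- Sums over finite subsets

-- The tail of `allFin (suc n)` is `map suc (allFin n)`; this turns counting in `b ∷ U` into
-- counting in `U`.
length-filter-map-suc : ∀ b (U : Subset n) (xs : List (Fin n)) →
                        length (filter (_∈? (b ∷ U)) (map suc xs)) ≡ length (filter (_∈? U) xs)
length-filter-map-suc b U []       = refl
length-filter-map-suc b U (x ∷ xs) with does (x ∈? U)
... | true  = cong suc (length-filter-map-suc b U xs)
... | false = length-filter-map-suc b U xs

length-elements : ∀ (U : Subset n) → length (elements U) ≡ ∣ U ∣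
length-elements []      = refl
length-elements {suc n} (b ∷ U)
  with tail ← trans (cong (length ∘ filter (_∈? (b ∷ U))) (sym (map-tabulate id suc)))
                    (trans (length-filter-map-suc b U (allFin n)) (length-elements U))
  with b
... | true  = cong suc tail
... | false = tail

sumOver : Subset n → (Fin n → ℕ) → ℕ
sumOver U f = sum (map f (elements U))

sum-map-const : ∀ k (xs : List A) → sum (map (const k) xs) ≡ length xs ℕ.* k
sum-map-const k []       = refl
sum-map-const k (_ ∷ xs) = cong (k ℕ.+_) (sum-map-const k xs)

module _ {f g : A → ℕ} where

  sum-map-+ : ∀ xs → sum (map (λ x → f x ℕ.+ g x) xs) ≡ sum (map f xs) ℕ.+ sum (map g xs)
  sum-map-+ []       = refl
  sum-map-+ (x ∷ xs) = trans (cong (f x ℕ.+ g x ℕ.+_) (sum-map-+ xs))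
                             (interchange ℕ.+-commutativeSemigroup (f x) (g x) _ _)

  sum-map-mono : ∀ xs → (∀ {x} → x ∈ᴸ xs → f x ℕ.≤ g x) → sum (map f xs) ℕ.≤ sum (map g xs)
  sum-map-mono []       f≤g = z≤n
  sum-map-mono (x ∷ xs) f≤g = ℕ.+-mono-≤ (f≤g (here refl)) (sum-map-mono xs (f≤g ∘ there))

module _ {f : A → ℕ} where

  -- Covers replace disjoint unions: an entry satisfying both `Q` and `R` is counted twice on the
  -- right, which an upper bound tolerates, so disjointness never has to be proved.
  sum-filter-cover : ∀ {P : Pred A p} {Q : Pred A q} {R : Pred A r}
                     (P? : Decidable P) (Q? : Decidable Q) (R? : Decidable R) →
                     (∀ {x} → P x → Q x ⊎ R x) → ∀ xs →
                     sum (map f (filter P? xs)) ℕ.≤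
                     sum (map f (filter Q? xs)) ℕ.+ sum (map f (filter R? xs))
  sum-filter-cover P? Q? R? cover []       = z≤n
  sum-filter-cover P? Q? R? cover (x ∷ xs)
    with ih ← sum-filter-cover P? Q? R? cover xs
       | b ← sum (map f (filter Q? xs)) in b≡ | c ← sum (map f (filter R? xs)) in c≡
       | P? x | Q? x | R? x
  ... | no _   | no _  | no _  rewrite b≡ | c≡ = ih
  ... | no _   | no _  | yes _ rewrite b≡ | c≡ =
    ℕ.≤-trans ih (ℕ.+-monoʳ-≤ b (ℕ.m≤n+m c (f x)))
  ... | no _   | yes _ | no _  rewrite b≡ | c≡ =
    ℕ.≤-trans ih (ℕ.+-monoˡ-≤ c (ℕ.m≤n+m b (f x)))
  ... | no _   | yes _ | yes _ rewrite b≡ | c≡ =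
    ℕ.≤-trans ih (ℕ.+-mono-≤ (ℕ.m≤n+m b (f x)) (ℕ.m≤n+m c (f x)))
  ... | yes px | no ¬q | no ¬r =
    contradiction (cover px) λ { (inj₁ qx) → ¬q qx ; (inj₂ rx) → ¬r rx }
  ... | yes _  | no _  | yes _ rewrite b≡ | c≡ =
    ℕ.≤-trans (ℕ.+-monoʳ-≤ (f x) ih)
              (ℕ.≤-reflexive (x∙yz≈y∙xz ℕ.+-commutativeSemigroup (f x) b c))
  ... | yes _  | yes _ | no _  rewrite b≡ | c≡ =
    ℕ.≤-trans (ℕ.+-monoʳ-≤ (f x) ih)
              (ℕ.≤-reflexive (sym (ℕ.+-assoc (f x) b c)))
  ... | yes _  | yes _ | yes _ rewrite b≡ | c≡ =
    ℕ.≤-trans (ℕ.+-monoʳ-≤ (f x) (ℕ.≤-trans ih (ℕ.+-monoʳ-≤ b (ℕ.m≤n+m c (f x)))))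
              (ℕ.≤-reflexive (sym (ℕ.+-assoc (f x) b (f x ℕ.+ c))))

  -- Induction keeps the smaller of the head and the minimizer found in the tail. Multiplying by the
  -- length keeps the comparison with the average in ℕ.
  minimum≤average : ∀ {x xs} → x ∈ᴸ xs → ∃[ y ] y ∈ᴸ xs × f y ℕ.* length xs ℕ.≤ sum (map f xs)
  minimum≤average {xs = x ∷ []} _ =
    x , here refl , ℕ.≤-reflexive (trans (ℕ.*-identityʳ (f x)) (sym (ℕ.+-identityʳ (f x))))
  minimum≤average {xs = x ∷ xs@(_ ∷ _)} _ with minimum≤average {xs = xs} (here refl)
  ... | y , y∈ , fy≤ with ℕ.≤-total (f x) (f y)
  ...   | inj₁ fx≤fy = x , here refl ,
          ℕ.≤-trans (ℕ.≤-reflexive (ℕ.*-suc (f x) (length xs)))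
                    (ℕ.+-monoʳ-≤ (f x) (ℕ.≤-trans (ℕ.*-monoˡ-≤ (length xs) fx≤fy) fy≤))
  ...   | inj₂ fy≤fx = y , there y∈ ,
          ℕ.≤-trans (ℕ.≤-reflexive (ℕ.*-suc (f y) (length xs))) (ℕ.+-mono-≤ fy≤fx fy≤)

χ : Subset n → Fin n → ℕ
χ W v = if does (v ∈? W) then 1 else 0

sumOver-≤ : ∀ (U : Subset n) {f k} → (∀ {v} → v ∈ U → f v ℕ.≤ k) → sumOver U f ℕ.≤ ∣ U ∣ ℕ.* k
sumOver-≤ U {f} {k} f≤k = begin
  sumOver U f                 ≤⟨ sum-map-mono (elements U) (f≤k ∘ ∈-elements⁻) ⟩
  sumOver U (const k)         ≡⟨ sum-map-const k (elements U) ⟩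
  length (elements U) ℕ.* k   ≡⟨ cong (ℕ._* k) (length-elements U) ⟩
  ∣ U ∣ ℕ.* k                 ∎
  where open ℕ.≤-Reasoning

sumOver-cover : ∀ {U V W : Subset n} → U ⊆ V ∪ W → ∀ f → sumOver U f ℕ.≤ sumOver V f ℕ.+ sumOver W f
sumOver-cover {U = U} {V} {W} U⊆ f =
  sum-filter-cover (_∈? U) (_∈? V) (_∈? W) (x∈p∪q⁻ V W ∘ U⊆) (allFin _)

sumOver-χ : ∀ (U W : Subset n) → sumOver U (χ W) ≡ ∣ W ∩ U ∣
sumOver-χ U W = trans (go (allFin _)) (length-elements (W ∩ U))
  where
  go : ∀ xs → sum (map (χ W) (filter (_∈? U) xs)) ≡ length (filter (_∈? (W ∩ U)) xs)
  go []       = refl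
  go (x ∷ xs) with x ∈? U | x ∈? (W ∩ U)
  ... | no _   | no _    = go xs
  ... | no x∉U | yes x∈  = contradiction (proj₂ (x∈p∩q⁻ W U x∈)) x∉U
  ... | yes x∈U | x∈?W∩U with x ∈? W | x∈?W∩U
  ...   | yes _   | yes _  = cong suc (go xs)
  ...   | no  _   | no _   = go xs
  ...   | yes x∈W | no x∉  = contradiction (x∈p∩q⁺ (x∈W , x∈U)) x∉
  ...   | no x∉W  | yes x∈ = contradiction (proj₁ (x∈p∩q⁻ W U x∈)) x∉W

⊆-remove : ∀ (U : Subset n) v → U ⊆ ⁅ v ⁆ ∪ (U - v)
⊆-remove U v {x} x∈U with x ≟ v
... | yes refl = x∈p∪q⁺ (inj₁ (x∈⁅x⁆ v))
... | no x≢v   = x∈p∪q⁺ (inj₂ (x∈p∧x≢y⇒x∈p-y x∈U x≢v))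

sumOver-remove : ∀ (U : Subset n) v f → sumOver U f ℕ.≤ f v ℕ.+ sumOver (U - v) f
sumOver-remove U v f = begin
  sumOver U f                              ≤⟨ sumOver-cover (⊆-remove U v) f ⟩
  sumOver ⁅ v ⁆ f ℕ.+ sumOver (U - v) f    ≤⟨ ℕ.+-monoˡ-≤ _ (sumOver-≤ ⁅ v ⁆ single) ⟩
  ∣ ⁅ v ⁆ ∣ ℕ.* f v ℕ.+ sumOver (U - v) f  ≡⟨ cong (λ k → k ℕ.* f v ℕ.+ sumOver (U - v) f) (∣⁅x⁆∣≡1 v) ⟩
  1 ℕ.* f v ℕ.+ sumOver (U - v) f          ≡⟨ cong (ℕ._+ sumOver (U - v) f) (ℕ.*-identityˡ (f v)) ⟩
  f v ℕ.+ sumOver (U - v) f                ∎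
  where
  open ℕ.≤-Reasoning
  single : ∀ {u} → u ∈ ⁅ v ⁆ → f u ℕ.≤ f v
  single u∈ = ℕ.≤-reflexive (cong f (x∈⁅y⁆⇒x≡y v u∈))

-- The instance `f = const 1` of `sumOver-remove`, since a cardinality is a sum of ones.
∣∣≤suc-remove : ∀ (U : Subset n) v → ∣ U ∣ ℕ.≤ suc ∣ U - v ∣
∣∣≤suc-remove U v = begin
  ∣ U ∣                                ≡⟨ count U ⟨
  sumOver U (const 1)                  ≤⟨ sumOver-remove U v (const 1) ⟩
  suc (sumOver (U - v) (const 1))      ≡⟨ cong suc (count (U - v)) ⟩
  suc ∣ U - v ∣                        ∎
  where
  open ℕ.≤-Reasoning
  count : ∀ W → sumOver W (const 1) ≡ ∣ W ∣
  count W = trans (sum-map-const 1 (elements W))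
                  (trans (ℕ.*-identityʳ _) (length-elements W))

-- Degree sums in graphs of bounded degeneracy

module _ (G : Graph n) where
  open Graph G

  -- Only a neighbor `u` of `v` can lose something, and then just `v` itself. Summed over `U`, the
  -- `χ` terms give the degree of `v` in G[U].
  degree-remove : ∀ (U : Subset n) v u → ∣ N u ∩ U ∣ ℕ.≤ ∣ N u ∩ (U - v) ∣ ℕ.+ χ (N v) u
  degree-remove U v u with u ∈? N v
  ... | yes _ = begin
    ∣ N u ∩ U ∣              ≤⟨ ∣∣≤suc-remove (N u ∩ U) v ⟩
    suc ∣ (N u ∩ U) - v ∣    ≤⟨ s≤s (p⊆q⇒∣p∣≤∣q∣ shrink) ⟩
    suc ∣ N u ∩ (U - v) ∣    ≡⟨ ℕ.+-comm 1 _ ⟩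
    ∣ N u ∩ (U - v) ∣ ℕ.+ 1  ∎
    where
    open ℕ.≤-Reasoning
    shrink : (N u ∩ U) - v ⊆ N u ∩ (U - v)
    shrink x∈ with x∈N , x∈U ← x∈p∩q⁻ (N u) U (p─q⊆p (N u ∩ U) ⁅ v ⁆ x∈) =
      x∈p∩q⁺ (x∈N , x∈p∧x∉q⇒x∈p─q x∈U (∈-─⁻ (N u ∩ U) ⁅ v ⁆ x∈))
  ... | no u∉Nv = ℕ.≤-trans (p⊆q⇒∣p∣≤∣q∣ shrink) (ℕ.m≤m+n _ 0)
    where
    shrink : N u ∩ U ⊆ N u ∩ (U - v)
    shrink x∈ with x∈N , x∈U ← x∈p∩q⁻ (N u) U x∈ =
      x∈p∩q⁺ (x∈N , x∈p∧x≢y⇒x∈p-y x∈U λ { refl → u∉Nv (N-sym x∈N) })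

  -- Removing a vertex v of degree at most d from G[U] lowers the degree sum by
  -- twice its degree: once for v itself and once through its neighbours.
  degreeSum≤ : ∀ {d} → HasDegeneracyBound G d → ∀ U →
               sumOver U (λ u → ∣ N u ∩ U ∣) ℕ.≤ ∣ U ∣ ℕ.* (2 ℕ.* d)
  degreeSum≤ {d} degenerate U = go U (<-wellFounded ∣ U ∣)
    where
    go : ∀ U → Acc ℕ._<_ ∣ U ∣ → sumOver U (λ u → ∣ N u ∩ U ∣) ℕ.≤ ∣ U ∣ ℕ.* (2 ℕ.* d)
    go U (acc rec) with nonempty? U
    ... | no empty = sumOver-≤ U λ {v} v∈U → contradiction (v , v∈U) empty
    ... | yes nonempty with v , v∈U , deg≤d ← degenerate U nonempty = begin
      sumOver U deg
        ≤⟨ sum-map-mono (elements U) (λ {u} _ → degree-remove U v u) ⟩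
      sumOver U (λ u → deg′ u ℕ.+ χ (N v) u)
        ≡⟨ sum-map-+ (elements U) ⟩
      sumOver U deg′ ℕ.+ sumOver U (χ (N v))
        ≡⟨ cong (sumOver U deg′ ℕ.+_) (sumOver-χ U (N v)) ⟩
      sumOver U deg′ ℕ.+ deg v
        ≤⟨ ℕ.+-monoˡ-≤ (deg v) (sumOver-remove U v deg′) ⟩
      deg′ v ℕ.+ sumOver (U - v) deg′ ℕ.+ deg v
        ≤⟨ ℕ.+-mono-≤ (ℕ.+-mono-≤ deg′≤d (go (U - v) (rec smaller))) deg≤d ⟩
      d ℕ.+ ∣ U - v ∣ ℕ.* (2 ℕ.* d) ℕ.+ d
        ≡⟨ solve 2 (λ d m → d :+ m :* (con 2 :* d) :+ d := (con 1 :+ m) :* (con 2 :* d)) refl d ∣ U - v ∣ ⟩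
      suc ∣ U - v ∣ ℕ.* (2 ℕ.* d)
        ≤⟨ ℕ.*-monoˡ-≤ (2 ℕ.* d) smaller ⟩
      ∣ U ∣ ℕ.* (2 ℕ.* d) ∎
      where
      open ℕ.≤-Reasoning
      open +-*-Solver using (solve; _:+_; _:*_; _:=_; con)
      deg deg′ : Fin n → ℕ
      deg u  = ∣ N u ∩ U ∣
      deg′ u = ∣ N u ∩ (U - v) ∣
      smaller : ∣ U - v ∣ ℕ.< ∣ U ∣
      smaller = x∈p⇒∣p-x∣<∣p∣ v∈U
      shrink : N v ∩ (U - v) ⊆ N v ∩ U
      shrink x∈ with x∈N , x∈U ← x∈p∩q⁻ (N v) (U - v) x∈ = x∈p∩q⁺ (x∈N , p─q⊆p U ⁅ v ⁆ x∈U)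
      deg′≤d : deg′ v ℕ.≤ d
      deg′≤d = ℕ.≤-trans (p⊆q⇒∣p∣≤∣q∣ shrink) deg≤d

-- Counting colors

unique⇒lookup-injective : ∀ {xs : List A} → Unique xs → ∀ {i j} → lookup xs i ≡ lookup xs j → i ≡ j
unique⇒lookup-injective (_   ∷ _)  {zero}  {zero}  _  = refl
unique⇒lookup-injective (x∉ ∷ _)   {zero}  {suc j} eq = contradiction eq (All.lookup x∉ (∈-lookup j))
unique⇒lookup-injective (x∉ ∷ _)   {suc i} {zero}  eq = contradiction (sym eq) (All.lookup x∉ (∈-lookup i))
unique⇒lookup-injective (_ ∷ xs!)  {suc i} {suc j} eq = cong suc (unique⇒lookup-injective xs! eq)

-- Pigeonhole: sending an index of `xs` to a position of its entry in `ys` is injective, because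
-- `xs` has no repetitions.
unique-⊆⇒length≤ : ∀ {xs ys : List A} → Unique xs → All (_∈ᴸ ys) xs → length xs ℕ.≤ length ys
unique-⊆⇒length≤ {xs = xs} {ys} xs! xs⊆ys = injective⇒≤ {f = position} λ {i} {j} eq →
  unique⇒lookup-injective xs!
    (trans (lookup-index (at i)) (trans (cong (lookup ys) eq) (sym (lookup-index (at j)))))
  where
  at : ∀ i → lookup xs i ∈ᴸ ys
  at i = All.lookup xs⊆ys (∈-lookup i)
  position : Fin (length xs) → Fin (length ys)
  position i = Any.index (at i)

open DecMembership ℕ._≟_ using () renaming (_∈?_ to _∈ᴸ?_)

-- Otherwise `xs` would contain the `m` distinct numbers 1,...,m, against its length.
freshColor : ∀ m (xs : List ℕ) → length xs ℕ.< m → ∃[ x ] 1 ℕ.≤ x × x ℕ.≤ m × x ∉ᴸ xs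
freshColor m xs len<m with All.all? (_∈ᴸ? xs) (applyUpTo suc m)
... | yes all = contradiction
        (subst (ℕ._≤ length xs) (length-applyUpTo suc m)
          (unique-⊆⇒length≤ (Unique.applyUpTo⁺₁ suc m (λ i<j _ eq → ℕ.<⇒≢ i<j (ℕ.suc-injective eq))) all))
        (ℕ.<⇒≱ len<m)
... | no ¬all with any ← All.¬All⇒Any¬ (_∈ᴸ? xs) (applyUpTo suc m) ¬all
              with i , i<m , eq ← ∈-applyUpTo⁻ suc {n = m} (∈-lookup {xs = applyUpTo suc m} (Any.index any)) =
  _ , subst (1 ℕ.≤_) (sym eq) (s≤s z≤n) , subst (ℕ._≤ m) (sym eq) i<m , lookup-index any

-- Ordered fields

module OrderedFieldProperties {c ℓ₁ ℓ₂} (K : ArchimedeanOrderedField c ℓ₁ ℓ₂) where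
  open ArchimedeanOrderedField K
  open CommutativeRing commutativeRing
    using (+-congˡ; +-congʳ; +-comm; +-assoc; +-identityˡ; +-identityʳ;
           *-congˡ; *-congʳ; *-comm; *-assoc; *-identityˡ; *-identityʳ; zeroʳ; distribˡ; distribʳ;
           -‿cong; -‿inverseˡ; -‿inverseʳ; ring; commutativeSemiring)
    renaming (refl to ≈-refl; sym to ≈-sym; trans to ≈-trans)
  open IsDecTotalOrder isDecTotalOrder using (isPartialOrder; total; antisym)
    renaming (refl to ≤-refl; trans to ≤-trans; ≤-respˡ-≈ to ≤-respˡ; ≤-respʳ-≈ to ≤-respʳ)
  open RingProperties ring using (-‿distribʳ-*; -‿involutive)
  open RingSolver commutativeSemiring using (Polynomial; solve; con; _:=_; _:+_; _:*_)

  poset : Poset _ _ _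
  poset = record { isPartialOrder = isPartialOrder }

  module ≤-Reasoning = PosetReasoning poset
  open ≤-Reasoning

  +-monoʳ-≤ : ∀ z {x y} → x ≤ y → (z + x) ≤ (z + y)
  +-monoʳ-≤ z {x} {y} x≤y = begin
    z + x  ≈⟨ +-comm z x ⟩
    x + z  ≤⟨ +-monoˡ-≤ z x≤y ⟩
    y + z  ≈⟨ +-comm y z ⟩
    z + y  ∎

  +-mono-≤ : ∀ {w x y z} → w ≤ x → y ≤ z → (w + y) ≤ (x + z)
  +-mono-≤ {x = x} {y} w≤x y≤z = ≤-trans (+-monoˡ-≤ y w≤x) (+-monoʳ-≤ x y≤z)

  +-cancelˡ-≤ : ∀ z {x y} → (z + x) ≤ (z + y) → x ≤ y
  +-cancelˡ-≤ z {x} {y} z+x≤z+y = begin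
    x                  ≈⟨ cancel x ⟨
    - z + (z + x)      ≤⟨ +-monoʳ-≤ (- z) z+x≤z+y ⟩
    - z + (z + y)      ≈⟨ cancel y ⟩
    y                  ∎
    where
    cancel : ∀ w → (- z + (z + w)) ≈ w
    cancel w = ≈-trans (≈-sym (+-assoc (- z) z w)) (≈-trans (+-congʳ (-‿inverseˡ z)) (+-identityˡ w))

  0≤-x : ∀ {x} → x ≤ 0# → 0# ≤ - x
  0≤-x {x} x≤0 = +-cancelˡ-≤ x (≤-respˡ (≈-sym (+-identityʳ x)) (≤-respʳ (≈-sym (-‿inverseʳ x)) x≤0))

  *-monoˡ-≤ : ∀ z {x y} → 0# ≤ z → x ≤ y → (z * x) ≤ (z * y)
  *-monoˡ-≤ z {x} {y} 0≤z x≤y = begin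
    z * x                    ≈⟨ +-identityʳ _ ⟨
    z * x + 0#               ≤⟨ +-monoʳ-≤ (z * x) (*-nonNegative 0≤z 0≤y-x) ⟩
    z * x + z * (y + - x)    ≈⟨ distribˡ z x (y + - x) ⟨
    z * (x + (y + - x))      ≈⟨ *-congˡ x+[y-x]≈y ⟩
    z * y                    ∎
    where
    x+[y-x]≈y : (x + (y + - x)) ≈ y
    x+[y-x]≈y = begin-equality
      x + (y + - x)    ≈⟨ +-congˡ (+-comm y (- x)) ⟩
      x + (- x + y)    ≈⟨ +-assoc x (- x) y ⟨
      x + - x + y      ≈⟨ +-congʳ (-‿inverseʳ x) ⟩
      0# + y           ≈⟨ +-identityˡ y ⟩
      y                ∎
    0≤y-x : 0# ≤ (y + - x)
    0≤y-x = ≤-respˡ (-‿inverseʳ x) (+-monoˡ-≤ (- x) x≤y)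

  *-monoʳ-≤ : ∀ z {x y} → 0# ≤ z → x ≤ y → (x * z) ≤ (y * z)
  *-monoʳ-≤ z {x} {y} 0≤z x≤y = ≤-respˡ (*-comm z x) (≤-respʳ (*-comm z y) (*-monoˡ-≤ z 0≤z x≤y))

  -- Were 1 ≤ 0, then -1 ≥ 0, and 1 = (-1)(-1) ≥ 0 all the same.
  0≤1 : 0# ≤ 1#
  0≤1 with total 0# 1#
  ... | inj₁ 0≤1 = 0≤1
  ... | inj₂ 1≤0 = ≤-respʳ square (*-nonNegative (0≤-x 1≤0) (0≤-x 1≤0))
    where
    square : (- 1# * - 1#) ≈ 1#
    square = ≈-trans (≈-sym (-‿distribʳ-* (- 1#) 1#)) (≈-trans (-‿cong (*-identityʳ (- 1#))) (-‿involutive 1#))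

  -- Shaped like the unfolding of `⟦ n ⟧`, so that its value is `⟦ n ⟧` by computation and the
  -- solver's equations match the field numerals.
  num : ∀ {m} → ℕ → Polynomial m
  num zero    = con 0
  num (suc n) = con 1 :+ num n

  ⟦⟧-* : ∀ m n → ⟦ m ℕ.* n ⟧ ≈ (⟦ m ⟧ * ⟦ n ⟧)
  ⟦⟧-* = Mult.×1-homo-* semiring

  0≤⟦⟧ : ∀ n → 0# ≤ ⟦ n ⟧
  0≤⟦⟧ zero    = ≤-refl
  0≤⟦⟧ (suc n) = ≤-respˡ (+-identityˡ 0#) (+-mono-≤ 0≤1 (0≤⟦⟧ n))

  ⟦⟧-mono-≤ : ∀ {m n} → m ℕ.≤ n → ⟦ m ⟧ ≤ ⟦ n ⟧
  ⟦⟧-mono-≤ {n = n} z≤n   = 0≤⟦⟧ n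
  ⟦⟧-mono-≤ (s≤s m≤n) = +-monoʳ-≤ 1# (⟦⟧-mono-≤ m≤n)

  -- Characteristic zero follows from the order: `⟦ suc n ⟧` is at least 1, so its vanishing would
  -- squeeze 1 between 0 and 0.
  ⟦suc⟧≉0 : ∀ n → ¬ (⟦ suc n ⟧ ≈ 0#)
  ⟦suc⟧≉0 n 1+n≈0 = 0≉1 (antisym 0≤1 (begin
    1#          ≈⟨ +-identityʳ 1# ⟨
    1# + 0#     ≤⟨ +-monoʳ-≤ 1# (0≤⟦⟧ n) ⟩
    ⟦ suc n ⟧   ≈⟨ 1+n≈0 ⟩
    0#          ∎))

  ⟦⟧-cancel-≤ : ∀ {m n} → ⟦ m ⟧ ≤ ⟦ n ⟧ → m ℕ.≤ n
  ⟦⟧-cancel-≤ {zero}  {n}     _   = z≤n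
  ⟦⟧-cancel-≤ {suc m} {zero}  m≤n = contradiction (antisym m≤n (0≤⟦⟧ (suc m))) (⟦suc⟧≉0 m)
  ⟦⟧-cancel-≤ {suc m} {suc n} m≤n = s≤s (⟦⟧-cancel-≤ (+-cancelˡ-≤ 1# m≤n))

  0≤⁻¹ : ∀ {x} → 0# ≤ x → ¬ (x ≈ 0#) → 0# ≤ x ⁻¹
  0≤⁻¹ {x} 0≤x x≉0 with total 0# (x ⁻¹)
  ... | inj₁ 0≤x⁻¹ = 0≤x⁻¹
  ... | inj₂ x⁻¹≤0 = contradiction (antisym 0≤1 (begin
    1#          ≈⟨ *-inverseʳ x x≉0 ⟨
    x * x ⁻¹    ≤⟨ *-monoˡ-≤ x 0≤x x⁻¹≤0 ⟩
    x * 0#      ≈⟨ zeroʳ x ⟩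
    0#          ∎)) 0≉1

  1≤⇒⟦⟧≉0 : ∀ {m} → 1 ℕ.≤ m → ¬ (⟦ m ⟧ ≈ 0#)
  1≤⇒⟦⟧≉0 {suc m} _ = ⟦suc⟧≉0 m

  module _ {m : ℕ} (1≤m : 1 ℕ.≤ m) where

    ⟦⟧≉0 : ¬ (⟦ m ⟧ ≈ 0#)
    ⟦⟧≉0 = 1≤⇒⟦⟧≉0 1≤m

    *-/-cancel : ∀ x → ((x * ⟦ m ⟧) / ⟦ m ⟧) ≈ x
    *-/-cancel x = begin-equality
      (x * ⟦ m ⟧) / ⟦ m ⟧      ≈⟨ *-assoc x ⟦ m ⟧ (⟦ m ⟧ ⁻¹) ⟩
      x * (⟦ m ⟧ / ⟦ m ⟧)      ≈⟨ *-congˡ (*-inverseʳ ⟦ m ⟧ ⟦⟧≉0) ⟩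
      x * 1#                   ≈⟨ *-identityʳ x ⟩
      x                        ∎

    /-*-cancel : ∀ x → (⟦ m ⟧ * (x / ⟦ m ⟧)) ≈ x
    /-*-cancel x = begin-equality
      ⟦ m ⟧ * (x / ⟦ m ⟧)      ≈⟨ *-assoc ⟦ m ⟧ x (⟦ m ⟧ ⁻¹) ⟨
      (⟦ m ⟧ * x) / ⟦ m ⟧      ≈⟨ *-congʳ (*-comm ⟦ m ⟧ x) ⟩
      (x * ⟦ m ⟧) / ⟦ m ⟧      ≈⟨ *-/-cancel x ⟩
      x                        ∎

    /-mono-≤ : ∀ {x y} → x ≤ y → (x / ⟦ m ⟧) ≤ (y / ⟦ m ⟧)
    /-mono-≤ = *-monoʳ-≤ (⟦ m ⟧ ⁻¹) (0≤⁻¹ (0≤⟦⟧ m) ⟦⟧≉0)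

    0≤/ : ∀ {x} → 0# ≤ x → 0# ≤ (x / ⟦ m ⟧)
    0≤/ 0≤x = *-nonNegative 0≤x (0≤⁻¹ (0≤⟦⟧ m) ⟦⟧≉0)

    /-≤ : ∀ {a b} → a ℕ.≤ m ℕ.* b → (⟦ a ⟧ / ⟦ m ⟧) ≤ ⟦ b ⟧
    /-≤ {a} {b} a≤mb = begin
      ⟦ a ⟧ / ⟦ m ⟧               ≤⟨ /-mono-≤ (⟦⟧-mono-≤ a≤mb) ⟩
      ⟦ m ℕ.* b ⟧ / ⟦ m ⟧         ≈⟨ *-congʳ (≈-trans (⟦⟧-* m b) (*-comm _ _)) ⟩
      (⟦ b ⟧ * ⟦ m ⟧) / ⟦ m ⟧     ≈⟨ *-/-cancel ⟦ b ⟧ ⟩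
      ⟦ b ⟧                       ∎

    ≤-/ : ∀ {a b} → b ℕ.* m ℕ.≤ a → ⟦ b ⟧ ≤ (⟦ a ⟧ / ⟦ m ⟧)
    ≤-/ {a} {b} bm≤a = begin
      ⟦ b ⟧                       ≈⟨ *-/-cancel ⟦ b ⟧ ⟨
      (⟦ b ⟧ * ⟦ m ⟧) / ⟦ m ⟧     ≈⟨ *-congʳ (⟦⟧-* b m) ⟨
      ⟦ b ℕ.* m ⟧ / ⟦ m ⟧         ≤⟨ /-mono-≤ (⟦⟧-mono-≤ bm≤a) ⟩
      ⟦ a ⟧ / ⟦ m ⟧               ∎

  ≤⌈⌉ : ∀ x → x ≤ ⟦ ⌈ x ⌉ ⟧
  ≤⌈⌉ x = proj₁ (proj₂ (ceiling x))

  ⌈⌉-least : ∀ {x m} → x ≤ ⟦ m ⟧ → ⌈ x ⌉ ℕ.≤ m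
  ⌈⌉-least {x} = proj₂ (proj₂ (ceiling x)) _

  -- If y ≤ x, then x + x ≤ y + y ≤ x + y, and x cancels. This avoids a division: ε ≤ 8 reads 12η ≤
  -- 8, while the palette estimate itself asks for 6η ≤ 4.
  ≤-halve : ∀ {x y} → (x + x) ≤ (y + y) → x ≤ y
  ≤-halve {x} {y} 2x≤2y with total x y
  ... | inj₁ x≤y = x≤y
  ... | inj₂ y≤x = +-cancelˡ-≤ x (≤-trans 2x≤2y (+-monoˡ-≤ y y≤x))

  x≤[1+y]x : ∀ {x y} → 0# ≤ x → 0# ≤ y → x ≤ ((1# + y) * x)
  x≤[1+y]x {x} {y} 0≤x 0≤y = begin
    x                  ≈⟨ *-identityˡ x ⟨
    1# * x             ≤⟨ *-monoʳ-≤ x 0≤x (≤-respˡ (+-identityʳ 1#) (+-monoʳ-≤ 1# 0≤y)) ⟩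
    (1# + y) * x       ∎

  0≤1+x : ∀ {x} → 0# ≤ x → 0# ≤ (1# + x)
  0≤1+x 0≤x = ≤-respˡ (+-identityˡ 0#) (+-mono-≤ 0≤1 0≤x)

  module Accuracy {ε : Carrier} (0<ε : 0# < ε) (ε≤8 : ε ≤ ⟦ 8 ⟧) where

    0≤ε : 0# ≤ ε
    0≤ε = proj₁ 0<ε

    η μ : Carrier
    η = ε / ⟦ 12 ⟧
    μ = ε / ⟦ 4 ⟧

    0≤η : 0# ≤ η
    0≤η = 0≤/ {12} (s≤s z≤n) 0≤ε

    0≤μ : 0# ≤ μ
    0≤μ = 0≤/ {4} (s≤s z≤n) 0≤ε

    12η≈ε : (⟦ 12 ⟧ * η) ≈ ε
    12η≈ε = /-*-cancel {12} (s≤s z≤n) ε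

    μ≈3η : μ ≈ (⟦ 3 ⟧ * η)
    μ≈3η = begin-equality
      ε / ⟦ 4 ⟧                        ≈⟨ *-congʳ 12η≈ε ⟨
      (⟦ 12 ⟧ * η) / ⟦ 4 ⟧             ≈⟨ *-congʳ (*-congʳ (⟦⟧-* 3 4)) ⟩
      (⟦ 3 ⟧ * ⟦ 4 ⟧ * η) / ⟦ 4 ⟧      ≈⟨ *-congʳ (solve 3 (λ x y z → x :* y :* z := x :* z :* y) ≈-refl ⟦ 3 ⟧ ⟦ 4 ⟧ η) ⟩
      (⟦ 3 ⟧ * η * ⟦ 4 ⟧) / ⟦ 4 ⟧      ≈⟨ *-/-cancel {4} (s≤s z≤n) (⟦ 3 ⟧ * η) ⟩
      ⟦ 3 ⟧ * η                        ∎

    -- With ε = 12η and μ = 3η, twice the difference of the two sides is (8 - ε)η.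
    [1+μ][1+η]2≤2+ε : ((1# + μ) * ((1# + η) * ⟦ 2 ⟧)) ≤ (⟦ 2 ⟧ + ε)
    [1+μ][1+η]2≤2+ε = begin
      (1# + μ) * ((1# + η) * ⟦ 2 ⟧)             ≈⟨ *-congʳ (+-congˡ μ≈3η) ⟩
      (1# + ⟦ 3 ⟧ * η) * ((1# + η) * ⟦ 2 ⟧)     ≤⟨ ≤-halve doubled ⟩
      ⟦ 2 ⟧ + ⟦ 12 ⟧ * η                        ≈⟨ +-congˡ 12η≈ε ⟩
      ⟦ 2 ⟧ + ε                                 ∎
      where
      lhs rhs : Carrier
      lhs = (1# + ⟦ 3 ⟧ * η) * ((1# + η) * ⟦ 2 ⟧)
      rhs = ⟦ 2 ⟧ + ⟦ 12 ⟧ * η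
      doubled : (lhs + lhs) ≤ (rhs + rhs)
      doubled = begin
        lhs + lhs
          ≈⟨ solve 1 (λ η → let L = (con 1 :+ num 3 :* η) :* ((con 1 :+ η) :* num 2) in
                            L :+ L := num 4 :+ num 16 :* η :+ num 12 :* η :* η) ≈-refl η ⟩
        ⟦ 4 ⟧ + ⟦ 16 ⟧ * η + ⟦ 12 ⟧ * η * η
          ≤⟨ +-monoʳ-≤ _ (*-monoʳ-≤ η 0≤η (≤-respˡ (≈-sym 12η≈ε) ε≤8)) ⟩
        ⟦ 4 ⟧ + ⟦ 16 ⟧ * η + ⟦ 8 ⟧ * η
          ≈⟨ solve 1 (λ η → let R = num 2 :+ num 12 :* η in
                            num 4 :+ num 16 :* η :+ num 8 :* η := R :+ R) ≈-refl η ⟩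
        rhs + rhs ∎

    0<μ : ¬ (μ ≤ 0#)
    0<μ μ≤0 = proj₂ 0<ε (antisym 0≤ε (begin
      ε              ≈⟨ /-*-cancel {4} (s≤s z≤n) ε ⟨
      ⟦ 4 ⟧ * μ      ≤⟨ *-monoˡ-≤ ⟦ 4 ⟧ (0≤⟦⟧ 4) μ≤0 ⟩
      ⟦ 4 ⟧ * 0#     ≈⟨ zeroʳ _ ⟩
      0#             ∎))

    -- If the ceiling were at most m, then m + μm ≤ m and hence μ ≤ μm ≤ 0. Here ε > 0 yields the
    -- one spare color on which progress rests.
    suc-≤⌈[1+μ]⌉ : ∀ m → 1 ℕ.≤ m → suc m ℕ.≤ ⌈ (1# + μ) * ⟦ m ⟧ ⌉
    suc-≤⌈[1+μ]⌉ m 1≤m = ℕ.≰⇒> λ ⌈⌉≤m → 0<μ (begin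
      μ              ≈⟨ *-identityʳ μ ⟨
      μ * 1#         ≈⟨ *-congˡ (+-identityʳ 1#) ⟨
      μ * ⟦ 1 ⟧      ≤⟨ *-monoˡ-≤ μ 0≤μ (⟦⟧-mono-≤ 1≤m) ⟩
      μ * ⟦ m ⟧      ≤⟨ +-cancelˡ-≤ ⟦ m ⟧ (begin
        ⟦ m ⟧ + μ * ⟦ m ⟧             ≈⟨ +-congʳ (*-identityˡ _) ⟨
        1# * ⟦ m ⟧ + μ * ⟦ m ⟧        ≈⟨ distribʳ ⟦ m ⟧ 1# μ ⟨
        (1# + μ) * ⟦ m ⟧              ≤⟨ ≤⌈⌉ _ ⟩
        ⟦ ⌈ (1# + μ) * ⟦ m ⟧ ⌉ ⟧      ≤⟨ ⟦⟧-mono-≤ ⌈⌉≤m ⟩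
        ⟦ m ⟧                         ≈⟨ +-identityʳ _ ⟨
        ⟦ m ⟧ + 0#                    ∎) ⟩
      0#             ∎)

    module _ (d : ℕ) where

      bound : ℕ
      bound = ⌈ (⟦ 2 ⟧ + ε) * ⟦ d ⟧ ⌉

      -- Serves the vertices with deg_ℓ(v) = 0, whose palette size k₀ is controlled by d alone.
      d≤bound : d ℕ.≤ bound
      d≤bound = ⟦⟧-cancel-≤ (begin
        ⟦ d ⟧                        ≈⟨ *-identityˡ _ ⟨
        1# * ⟦ d ⟧                   ≤⟨ *-monoʳ-≤ ⟦ d ⟧ (0≤⟦⟧ d) 1≤2+ε ⟩
        (⟦ 2 ⟧ + ε) * ⟦ d ⟧          ≤⟨ ≤⌈⌉ _ ⟩
        ⟦ bound ⟧                    ∎)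
        where
        1≤2+ε : 1# ≤ (⟦ 2 ⟧ + ε)
        1≤2+ε = begin
          1#              ≈⟨ ≈-trans (+-identityʳ _) (+-identityʳ 1#) ⟨
          ⟦ 1 ⟧ + 0#      ≤⟨ +-mono-≤ (⟦⟧-mono-≤ {1} {2} (s≤s z≤n)) 0≤ε ⟩
          ⟦ 2 ⟧ + ε       ∎

      -- Rounding up the palette costs nothing: `bound` is a natural number above (1 + μ)m, so it is
      -- also above the least such number.
      ⌈[1+μ]⌉≤bound : ∀ m → ⟦ m ⟧ ≤ ((1# + η) * ⟦ 2 ℕ.* d ⟧) → ⌈ (1# + μ) * ⟦ m ⟧ ⌉ ℕ.≤ bound
      ⌈[1+μ]⌉≤bound m m≤ = ⌈⌉-least (begin
        (1# + μ) * ⟦ m ⟧                            ≤⟨ *-monoˡ-≤ (1# + μ) (0≤1+x 0≤μ) m≤ ⟩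
        (1# + μ) * ((1# + η) * ⟦ 2 ℕ.* d ⟧)         ≈⟨ *-congˡ (*-congˡ (⟦⟧-* 2 d)) ⟩
        (1# + μ) * ((1# + η) * (⟦ 2 ⟧ * ⟦ d ⟧))     ≈⟨ ≈-trans (*-congˡ (≈-sym (*-assoc _ _ _))) (≈-sym (*-assoc _ _ _)) ⟩
        ((1# + μ) * ((1# + η) * ⟦ 2 ⟧)) * ⟦ d ⟧     ≤⟨ *-monoʳ-≤ ⟦ d ⟧ (0≤⟦⟧ d) [1+μ][1+η]2≤2+ε ⟩
        (⟦ 2 ⟧ + ε) * ⟦ d ⟧                         ≤⟨ ≤⌈⌉ _ ⟩
        ⟦ bound ⟧                                   ∎)

-- The algorithms

nonempty⇒1≤∣∣ : ∀ {U : Subset n} → Nonempty U → 1 ℕ.≤ ∣ U ∣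
nonempty⇒1≤∣∣ (_ , v∈U) = ℕ.≤-trans (s≤s z≤n) (x∈p⇒∣p-x∣<∣p∣ v∈U)

-- ADG: termination and degrees among the remaining vertices

module ADGProperties {c ℓ₁ ℓ₂} (K : ArchimedeanOrderedField c ℓ₁ ℓ₂) {n : ℕ} (G : Graph n)
                     (η : ArchimedeanOrderedField.Carrier K)
                     (0≤η : ArchimedeanOrderedField._≤_ K (ArchimedeanOrderedField.0# K) η) where
  open ArchimedeanOrderedField K
  open OrderedFieldProperties K
  open Graph G
  open ADG K G η

  selected? : ∀ U D u → Dec (u ∈ U × ⟦ D u ⟧ ≤ ((1# + η) * δ̂ U D))
  selected? U D u = (u ∈? U) ×-dec (⟦ D u ⟧ ≤? ((1# + η) * δ̂ U D))

  select⊆ : ∀ U D → select U D ⊆ U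
  select⊆ U D = proj₁ ∘ ∈-subsetOf⁻ (selected? U D)

  -- A vertex minimizing `D` lies at or below the average, hence below the threshold because η ≥ 0.
  -- This is what makes the loop of ADG terminate.
  select-nonempty : ∀ {U} D → Nonempty U → Nonempty (select U D)
  select-nonempty {U} D nonempty@(_ , v∈U)
    with u , u∈ , Du≤ ← minimum≤average {f = D} (∈-elements⁺ v∈U) =
    u , ∈-subsetOf⁺ (selected? U D) (∈-elements⁻ u∈ , (begin
      ⟦ D u ⟧              ≤⟨ ≤-/ 1≤∣U∣ {b = D u} (subst (λ l → D u ℕ.* l ℕ.≤ sumOver U D) (length-elements U) Du≤) ⟩
      δ̂ U D                ≤⟨ x≤[1+y]x (0≤/ 1≤∣U∣ (0≤⟦⟧ (sumOver U D))) 0≤η ⟩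
      (1# + η) * δ̂ U D     ∎))
    where
    open ≤-Reasoning
    1≤∣U∣ : 1 ℕ.≤ ∣ U ∣
    1≤∣U∣ = nonempty⇒1≤∣∣ nonempty

  loop-terminates : ∀ U D → ∃[ Rs ] Loop U D Rs
  loop-terminates U D = go U D (<-wellFounded ∣ U ∣)
    where
    go : ∀ U D → Acc ℕ._<_ ∣ U ∣ → ∃[ Rs ] Loop U D Rs
    go U D (acc rec) with nonempty? U
    ... | no empty = [] , stop empty
    ... | yes nonempty
      with u , u∈ ← select-nonempty D nonempty
      with Rs , loop ← go (U ─ select U D) (decrement U (select U D) D)
             (rec (p∩q≢∅⇒∣p─q∣<∣p∣ U (select U D) (u , x∈p∩q⁺ (select⊆ U D u∈ , u∈))))
      = select U D ∷ Rs , iter nonempty loop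

  -- The loop invariant of ADG; under it `δ̂ U D` is the average degree of G[U].
  DegreesIn : Subset n → (Fin n → ℕ) → Set
  DegreesIn U D = ∀ {u} → u ∈ U → D u ≡ ∣ N u ∩ U ∣

  -- By symmetry of adjacency and `R ⊆ U`, the decrement of `u` is the size of `(N u ∩ U) ∩ R`. That
  -- set is part of `N u ∩ U`, so the truncated subtraction is exact.
  decrement-degrees : ∀ {U R D} → R ⊆ U → DegreesIn U D → DegreesIn (U ─ R) (decrement U R D)
  decrement-degrees {U} {R} {D} R⊆U degrees {u} u∈U─R = begin-equality
    D u ℕ.∸ ∣ S ∣
      ≡⟨ cong₂ ℕ._∸_ (degrees (p─q⊆p U R u∈U─R)) (cong ∣_∣ S≡) ⟩
    ∣ N u ∩ U ∣ ℕ.∸ ∣ (N u ∩ U) ∩ R ∣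
      ≡⟨ cong (ℕ._∸ ∣ (N u ∩ U) ∩ R ∣) (∣─∣+∣∩∣ (N u ∩ U) R) ⟨
    ∣ (N u ∩ U) ─ R ∣ ℕ.+ ∣ (N u ∩ U) ∩ R ∣ ℕ.∸ ∣ (N u ∩ U) ∩ R ∣
      ≡⟨ ℕ.m+n∸n≡m _ ∣ (N u ∩ U) ∩ R ∣ ⟩
    ∣ (N u ∩ U) ─ R ∣
      ≡⟨ cong ∣_∣ ─≡ ⟩
    ∣ N u ∩ (U ─ R) ∣ ∎
    where
    open ℕ.≤-Reasoning
    P? : ∀ v → Dec (v ∈ R × u ∈ N v ∩ U)
    P? v = (v ∈? R) ×-dec (u ∈? (N v ∩ U))
    S : Subset n
    S = subsetOf P?
    S≡ : S ≡ (N u ∩ U) ∩ R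
    S≡ = ⊆-antisym
      (λ v∈ → let v∈R , u∈ = ∈-subsetOf⁻ P? v∈; u∈N , _ = x∈p∩q⁻ (N _) U u∈ in
              x∈p∩q⁺ (x∈p∩q⁺ (N-sym u∈N , R⊆U v∈R) , v∈R))
      (λ v∈ → let v∈NU , v∈R = x∈p∩q⁻ (N u ∩ U) R v∈ in
              ∈-subsetOf⁺ P? (v∈R , x∈p∩q⁺ (N-sym (proj₁ (x∈p∩q⁻ (N u) U v∈NU)) , p─q⊆p U R u∈U─R)))
    ─≡ : (N u ∩ U) ─ R ≡ N u ∩ (U ─ R)
    ─≡ = ⊆-antisym
      (λ v∈ → let v∈N , v∈U = x∈p∩q⁻ (N u) U (p─q⊆p (N u ∩ U) R v∈) in
              x∈p∩q⁺ (v∈N , x∈p∧x∉q⇒x∈p─q v∈U (∈-─⁻ (N u ∩ U) R v∈)))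
      (λ v∈ → let v∈N , v∈U─R = x∈p∩q⁻ (N u) (U ─ R) v∈ in
              x∈p∧x∉q⇒x∈p─q (x∈p∩q⁺ (v∈N , p─q⊆p U R v∈U─R)) (∈-─⁻ U R v∈U─R))

  select-degree : ∀ {d U D} → HasDegeneracyBound G d → Nonempty U → DegreesIn U D →
                  ∀ {u} → u ∈ select U D → ⟦ ∣ N u ∩ U ∣ ⟧ ≤ ((1# + η) * ⟦ 2 ℕ.* d ⟧)
  select-degree {d} {U} {D} degenerate nonempty degrees {u} u∈ = begin
    ⟦ ∣ N u ∩ U ∣ ⟧            ≡⟨ cong ⟦_⟧ (degrees (select⊆ U D u∈)) ⟨
    ⟦ D u ⟧                    ≤⟨ proj₂ (∈-subsetOf⁻ (selected? U D) u∈) ⟩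
    (1# + η) * δ̂ U D           ≤⟨ *-monoˡ-≤ (1# + η) (0≤1+x 0≤η) (/-≤ (nonempty⇒1≤∣∣ nonempty) sum≤) ⟩
    (1# + η) * ⟦ 2 ℕ.* d ⟧     ∎
    where
    open ≤-Reasoning
    sum≤ : sumOver U D ℕ.≤ ∣ U ∣ ℕ.* (2 ℕ.* d)
    sum≤ = ℕ.≤-trans (sum-map-mono (elements U) (λ v∈ → ℕ.≤-reflexive (degrees (∈-elements⁻ v∈))))
                     (degreeSum≤ G degenerate U)

numColors≤ : ∀ {M} (C : Fin n → ℕ) → (∀ v → 1 ℕ.≤ C v × C v ℕ.≤ M) → numColors C ℕ.≤ M
numColors≤ {M = M} C colored = subst (numColors C ℕ.≤_) (length-applyUpTo suc M)
  (unique-⊆⇒length≤ (deduplicate-! ℕ._≟_ (map C (allFin _)))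
                     (All.deduplicate⁺ ℕ._≟_ (All.map⁺ (All.tabulate⁺ inRange))))
  where
  inRange : ∀ v → C v ∈ᴸ applyUpTo suc M
  inRange v with C v | colored v
  ... | suc i | _ , i<M = ∈-applyUpTo⁺ suc i<M

-- DEC-ADG: invariant, properness and progress

module DecADGProperties {k ℓ₁ ℓ₂} (K : ArchimedeanOrderedField k ℓ₁ ℓ₂) {n : ℕ} (G : Graph n)
                        (ε : ArchimedeanOrderedField.Carrier K) (k₀ M : ℕ) where
  open Graph G
  open DecADG K G ε k₀

  -- In `Schedule A P`, `A` holds the vertices treated before the parts in `P`. Since `A` grows
  -- along the list, `A ∪ R` is the set in which deg_ℓ is taken for the part `R`.
  data Schedule : Subset n → List (Subset n) → Set where
    done : ∀ {A} → (∀ v → v ∈ A) → Schedule A []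
    next : ∀ {A R P} → (∀ {v} → v ∈ R → v ∉ A) →
           (∀ {v} → v ∈ R → paletteSize ∣ N v ∩ (A ∪ R) ∣ ℕ.≤ M) →
           Schedule (A ∪ R) P → Schedule A (R ∷ P)

  -- The colored vertices are those of `Q ∪ R` outside `U`. `complete` preserves `proper` when a
  -- vertex receives a color; `sound` limits the colors forbidden at `v` to those of its deg_ℓ(v)
  -- neighbors, which progress needs.
  record Invariant (s : State) : Set where
    constructor mkInvariant
    open State s
    field
      schedule : Schedule (Q ∪ R) pending
      U⊆R      : U ⊆ R
      palette≤ : ∀ {v} → v ∈ R → paletteSize (degℓ Q R v) ℕ.≤ M
      colored  : ∀ {v} → v ∈ Q ∪ R → v ∉ U → 1 ℕ.≤ C v × C v ℕ.≤ M
      proper   : ∀ {u v} → u ∈ Q ∪ R → u ∉ U → v ∈ Q ∪ R → v ∉ U → u ∈ N v → C u ≢ C v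
      sound    : ∀ {v x} → x ∈ᴸ B v → ∃[ u ] u ∈ N v ∩ (Q ∪ R) × u ∉ U × x ≡ C u
      complete : ∀ {u v} → v ∈ U → u ∈ N v ∩ (Q ∪ R) → u ∉ U → C u ∈ᴸ B v

  initial-invariant : ∀ {Rs} → Schedule ∅ (reverse Rs) → Invariant (initial Rs)
  initial-invariant {Rs} schedule = mkInvariant
    (subst (λ A → Schedule A (reverse Rs)) (sym (∪-identityˡ ∅)) schedule)
    id
    (λ v∈∅ → contradiction v∈∅ ∉⊥)
    (λ v∈∅ _ → contradiction v∈∅ ∉∅∪∅)
    (λ u∈∅ → contradiction u∈∅ ∉∅∪∅)
    (λ ())
    (λ v∈∅ → contradiction v∈∅ ∉⊥)
    where
    ∉∅∪∅ : ∀ {v} → v ∉ ∅ ∪ ∅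
    ∉∅∪∅ v∈ = [ ∉⊥ , ∉⊥ ] (x∈p∪q⁻ ∅ ∅ v∈)

  module Resolve (U : Subset n) (C : Fin n → ℕ) (B : Fin n → List ℕ) (c : Fin n → ℕ) where

    NoConflict : Fin n → Set
    NoConflict v = (∀ {u} → u ∈ N v ∩ U → c u ≢ c v) × c v ∉ᴸ B v

    Conflict : Fin n → Set
    Conflict v = (∃[ u ] u ∈ N v ∩ U × c u ≡ c v) ⊎ c v ∈ᴸ B v

    conflict? : ∀ v → Dec (Conflict v)
    conflict? v = any? (λ u → (u ∈? (N v ∩ U)) ×-dec (c u ℕ.≟ c v)) ⊎-dec (c v ∈ᴸ? B v)

    C′ : Fin n → ℕ
    C′ = resolve U C B c

    resolve-∉ : ∀ {v} → v ∉ U → C′ v ≡ C v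
    resolve-∉ {v} v∉U rewrite dec-false (v ∈? U) v∉U = refl

    resolve-conflict : ∀ {v} → v ∈ U → Conflict v → C′ v ≡ 0
    resolve-conflict {v} v∈U conflict
      rewrite dec-true (v ∈? U) v∈U | dec-true (conflict? v) conflict = refl

    resolve-noConflict : ∀ {v} → v ∈ U → NoConflict v → C′ v ≡ c v
    resolve-noConflict {v} v∈U (distinct , allowed)
      rewrite dec-true (v ∈? U) v∈U
            | dec-false (conflict? v) [ (λ { (u , u∈ , eq) → distinct u∈ eq }) , allowed ] = refl

    resolve-∈ : ∀ {v} → v ∈ U → C′ v ≢ 0 → C′ v ≡ c v × NoConflict v
    resolve-∈ {v} v∈U C′v≢0 with conflict? v
    ... | yes conflict = contradiction (resolve-conflict v∈U conflict) C′v≢0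
    ... | no ¬conflict = resolve-noConflict v∈U free , free
      where
      free : NoConflict v
      free = (λ {u} u∈ eq → ¬conflict (inj₁ (u , u∈ , eq))) , ¬conflict ∘ inj₂

    U′ : Subset n
    U′ = uncolored U C′

    ∈-uncolored⁻ : ∀ {v} → v ∈ U′ → v ∈ U × C′ v ≡ 0
    ∈-uncolored⁻ = ∈-subsetOf⁻ (λ v → (v ∈? U) ×-dec (C′ v ℕ.≟ 0))

    uncolored⊆ : U′ ⊆ U
    uncolored⊆ = proj₁ ∘ ∈-uncolored⁻

    -- The dichotomy behind the `round` case of the invariant: a vertex is untouched by the round or
    -- colored in it. In the latter case its color is nonzero, so it was not reset and had no
    -- conflict.
    ∉-uncolored : ∀ {v} → v ∉ U′ →
                  (v ∉ U × C′ v ≡ C v) ⊎ (v ∈ U × C′ v ≢ 0 × C′ v ≡ c v × NoConflict v)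
    ∉-uncolored {v} v∉U′ with toSum (v ∈? U)
    ... | inj₂ v∉U = inj₁ (v∉U , resolve-∉ v∉U)
    ... | inj₁ v∈U = inj₂ (v∈U , C′v≢0 , resolve-∈ v∈U C′v≢0)
      where
      C′v≢0 : C′ v ≢ 0
      C′v≢0 C′v≡0 = v∉U′ (∈-subsetOf⁺ (λ v → (v ∈? U) ×-dec (C′ v ℕ.≟ 0)) (v∈U , C′v≡0))

    B′ : Fin n → List ℕ
    B′ = insertFresh U C′ B

    ∈-insertFresh⁻ : ∀ {v x} → x ∈ᴸ B′ v → x ∈ᴸ B v ⊎ (∃[ u ] u ∈ N v ∩ U × x ≡ C′ u × 0 ℕ.< x)
    ∈-insertFresh⁻ {v} x∈ with does (v ∈? U)
    ... | false = inj₁ x∈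
    ... | true with ∈-++⁻ (filter (0 ℕ.<?_) (map C′ (elements (N v ∩ U)))) x∈
    ...   | inj₂ x∈B = inj₁ x∈B
    ...   | inj₁ x∈fresh with x∈map , 0<x ← ∈-filter⁻ (0 ℕ.<?_) {xs = map C′ (elements (N v ∩ U))} x∈fresh
                         with u , u∈ , refl ← ∈-map⁻ C′ x∈map = inj₂ (u , ∈-elements⁻ u∈ , refl , 0<x)

    ∈-insertFresh-old : ∀ {v x} → x ∈ᴸ B v → x ∈ᴸ B′ v
    ∈-insertFresh-old {v} x∈ with does (v ∈? U)
    ... | false = x∈
    ... | true  = ∈-++⁺ʳ (filter (0 ℕ.<?_) (map C′ (elements (N v ∩ U)))) x∈

    ∈-insertFresh-new : ∀ {u v} → v ∈ U → u ∈ N v ∩ U → C′ u ≢ 0 → C′ u ∈ᴸ B′ v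
    ∈-insertFresh-new {u} {v} v∈U u∈ C′u≢0 with does (v ∈? U) | dec-true (v ∈? U) v∈U
    ... | true | refl = ∈-++⁺ˡ (∈-filter⁺ (0 ℕ.<?_) (∈-map⁺ C′ (∈-elements⁺ u∈)) (ℕ.n≢0⇒n>0 C′u≢0))

  ∈-insertColored⁻ : ∀ Q R C B {v x} → x ∈ᴸ insertColored Q R C B v →
                     x ∈ᴸ B v ⊎ (∃[ u ] u ∈ N v ∩ Q × x ≡ C u)
  ∈-insertColored⁻ Q R C B {v} x∈ with does (v ∈? R)
  ... | false = inj₁ x∈
  ... | true with ∈-++⁻ (map C (elements (N v ∩ Q))) x∈
  ...   | inj₂ x∈B = inj₁ x∈B
  ...   | inj₁ x∈map with u , u∈ , refl ← ∈-map⁻ C x∈map = inj₂ (u , ∈-elements⁻ u∈ , refl)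

  ∈-insertColored⁺ : ∀ Q R C B {u v} → v ∈ R → u ∈ N v ∩ Q → C u ∈ᴸ insertColored Q R C B v
  ∈-insertColored⁺ Q R C B {u} {v} v∈R u∈ with does (v ∈? R) | dec-true (v ∈? R) v∈R
  ... | true | refl = ∈-++⁺ˡ (∈-map⁺ C (∈-elements⁺ u∈))

  -- In `advance`, the colored set stays the same: `U` was empty, and the whole new part enters
  -- uncolored. In `round`, two neighbors colored together differ because neither had a conflict
  -- inside `U`.
  step-invariant : ∀ {s t} → s ⟶ t → Invariant s → Invariant t
  step-invariant (advance {R′} {P} {Q} {R} {U} {C} {B} empty)
                 (mkInvariant (next disjoint palette≤′ schedule) U⊆R palette≤ colored proper sound complete) =
    mkInvariant schedule id palette≤′
      (λ v∈ v∉ → colored (old v∈ v∉) ∉U)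
      (λ u∈ u∉ v∈ v∉ → proper (old u∈ u∉) ∉U (old v∈ v∉) ∉U)
      sound′
      (λ {u} {v} v∈ u∈ u∉ → ∈-insertColored⁺ (Q ∪ R) R′ C B v∈
        (let u∈N , u∈A = x∈p∩q⁻ (N v) _ u∈ in x∈p∩q⁺ (u∈N , old u∈A u∉)))
    where
    ∉U : ∀ {v} → v ∉ U
    ∉U v∈U = empty (_ , v∈U)
    old : ∀ {v} → v ∈ (Q ∪ R) ∪ R′ → v ∉ R′ → v ∈ Q ∪ R
    old v∈ v∉R′ = [ id , (λ v∈R′ → contradiction v∈R′ v∉R′) ] (x∈p∪q⁻ (Q ∪ R) R′ v∈)
    -- Disjointness of the parts keeps earlier neighbors outside the new `U`, which is `R′`.
    widen : ∀ {u v} → u ∈ N v ∩ (Q ∪ R) → u ∈ N v ∩ ((Q ∪ R) ∪ R′) × u ∉ R′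
    widen {u} {v} u∈ with u∈N , u∈A ← x∈p∩q⁻ (N v) (Q ∪ R) u∈ =
      x∈p∩q⁺ (u∈N , p⊆p∪q R′ u∈A) , λ u∈R′ → disjoint u∈R′ u∈A
    sound′ : ∀ {v x} → x ∈ᴸ insertColored (Q ∪ R) R′ C B v →
             ∃[ u ] u ∈ N v ∩ ((Q ∪ R) ∪ R′) × u ∉ R′ × x ≡ C u
    sound′ x∈ with ∈-insertColored⁻ (Q ∪ R) R′ C B x∈
    ... | inj₂ (u , u∈ , eq) with u∈′ , u∉ ← widen u∈ = u , u∈′ , u∉ , eq
    ... | inj₁ x∈B with u , u∈ , _ , eq ← sound x∈B with u∈′ , u∉ ← widen u∈ = u , u∈′ , u∉ , eq
  step-invariant (round {P} {Q} {R} {U} {C} {B} c nonempty admissible)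
                 (mkInvariant schedule U⊆R palette≤ colored proper sound complete) =
    mkInvariant schedule (U⊆R ∘ uncolored⊆) palette≤ colored′ proper′ sound′ complete′
    where
    open Resolve U C B c
    colored′ : ∀ {v} → v ∈ Q ∪ R → v ∉ U′ → 1 ℕ.≤ C′ v × C′ v ℕ.≤ M
    colored′ {v} v∈ v∉ with ∉-uncolored v∉
    ... | inj₁ (v∉U , eq) = subst (λ x → 1 ℕ.≤ x × x ℕ.≤ M) (sym eq) (colored v∈ v∉U)
    ... | inj₂ (v∈U , _ , eq , _) with 1≤c , c≤ ← admissible v v∈U =
      subst (λ x → 1 ℕ.≤ x × x ℕ.≤ M) (sym eq) (1≤c , ℕ.≤-trans c≤ (palette≤ (U⊆R v∈U)))
    -- By `complete`, the old color of `u` is already forbidden at `v`, so an unconflicted `v`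
    -- cannot have chosen it.
    newOld : ∀ {u v} → v ∈ U → C′ v ≡ c v → NoConflict v →
             u ∈ Q ∪ R → u ∉ U → C′ u ≡ C u → u ∈ N v → C′ u ≢ C′ v
    newOld {u} {v} v∈U C′v≡ (_ , allowed) u∈ u∉U C′u≡ u∈N eq =
      allowed (subst (_∈ᴸ B v) (trans (sym C′u≡) (trans eq C′v≡)) (complete v∈U (x∈p∩q⁺ (u∈N , u∈)) u∉U))
    proper′ : ∀ {u v} → u ∈ Q ∪ R → u ∉ U′ → v ∈ Q ∪ R → v ∉ U′ → u ∈ N v → C′ u ≢ C′ v
    proper′ u∈ u∉ v∈ v∉ u∈N eq with ∉-uncolored u∉ | ∉-uncolored v∉
    ... | inj₁ (u∉U , equ) | inj₁ (v∉U , eqv) =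
      proper u∈ u∉U v∈ v∉U u∈N (trans (sym equ) (trans eq eqv))
    ... | inj₁ (u∉U , equ) | inj₂ (v∈U , _ , eqv , free) = newOld v∈U eqv free u∈ u∉U equ u∈N eq
    ... | inj₂ (u∈U , _ , equ , free) | inj₁ (v∉U , eqv) =
      newOld u∈U equ free v∈ v∉U eqv (N-sym u∈N) (sym eq)
    ... | inj₂ (u∈U , _ , equ , _) | inj₂ (v∈U , _ , eqv , distinct , _) =
      distinct (x∈p∩q⁺ (u∈N , u∈U)) (trans (sym equ) (trans eq eqv))
    sound′ : ∀ {v x} → x ∈ᴸ B′ v → ∃[ u ] u ∈ N v ∩ (Q ∪ R) × u ∉ U′ × x ≡ C′ u
    sound′ {v} x∈ with ∈-insertFresh⁻ x∈
    ... | inj₁ x∈B with u , u∈ , u∉U , eq ← sound x∈B =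
      u , u∈ , u∉U ∘ uncolored⊆ , trans eq (sym (resolve-∉ u∉U))
    ... | inj₂ (u , u∈ , eq , 0<x) with u∈N , u∈U ← x∈p∩q⁻ (N v) U u∈ =
      u , x∈p∩q⁺ (u∈N , q⊆p∪q Q R (U⊆R u∈U)) ,
      -- The inserted color is positive, whereas vertices remaining in `U′` have color 0.
      (λ u∈U′ → ℕ.<⇒≢ 0<x (sym (trans eq (proj₂ (∈-uncolored⁻ u∈U′))))) , eq
    complete′ : ∀ {u v} → v ∈ U′ → u ∈ N v ∩ (Q ∪ R) → u ∉ U′ → C′ u ∈ᴸ B′ v
    complete′ {u} {v} v∈U′ u∈ u∉U′ with v∈U ← uncolored⊆ v∈U′ | ∉-uncolored u∉U′
    ... | inj₁ (u∉U , eq) = ∈-insertFresh-old (subst (_∈ᴸ B v) (sym eq) (complete v∈U u∈ u∉U))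
    ... | inj₂ (u∈U , C′u≢0 , _) =
      ∈-insertFresh-new v∈U (x∈p∩q⁺ (proj₁ (x∈p∩q⁻ (N v) (Q ∪ R) u∈) , u∈U)) C′u≢0

  steps-invariant : ∀ {s t} → s ⟶* t → Invariant s → Invariant t
  steps-invariant ε*         inv = inv
  steps-invariant (st ◅ sts) inv = steps-invariant sts (step-invariant st inv)

  -- With no pending part the schedule must be `done`, so `Q ∪ R` consists of all vertices.
  finished-colored : ∀ {s} → Finished s → Invariant s → ∀ v → 1 ℕ.≤ State.C s v × State.C s v ℕ.≤ M
  finished-colored (refl , empty) inv@record { schedule = done all } v =
    Invariant.colored inv (all v) (λ v∈U → empty (v , v∈U))

  finished-coloring : ∀ {s} → Finished s → Invariant s → IsColoring G (State.C s)
  finished-coloring fin@(refl , empty) inv@record { schedule = done all } =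
    proj₁ ∘ finished-colored fin inv ,
    λ {u} {v} → Invariant.proper inv (all u) (λ u∈U → empty (u , u∈U)) (all v) (λ v∈U → empty (v , v∈U))

  -- If every vertex of U other than v picks color 1, then v avoids a conflict by
  -- picking any color outside the image of N v ∩ (Q ∪ R) under C, corrected to 1 on U.
  module Progress (palette> : ∀ m → suc m ℕ.≤ paletteSize m) where

    progress : ∀ P Q R U C B → Nonempty U → Invariant ⟨ P , Q , R , U , C , B ⟩ →
               ∃[ U′ ] ∃[ C′ ] ∃[ B′ ] ∣ U′ ∣ ℕ.< ∣ U ∣ ×
               (⟨ P , Q , R , U , C , B ⟩ ⟶ ⟨ P , Q , R , U′ , C′ , B′ ⟩)
    progress P Q R U C B nonempty@(v , v∈U) inv =
      U′ , C′ , B′ , p⊂q⇒∣p∣<∣q∣ (uncolored⊆ , v , v∈U , v∉U′) , round c nonempty admissible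
      where
      open Invariant inv
      W : Subset n
      W = N v ∩ (Q ∪ R)
      g : Fin n → ℕ
      g u = if does (u ∈? U) then 1 else C u
      forbidden : List ℕ
      forbidden = map g (elements W)
      fresh : ∃[ x ] 1 ℕ.≤ x × x ℕ.≤ paletteSize (degℓ Q R v) × x ∉ᴸ forbidden
      fresh = freshColor _ forbidden
        (subst (ℕ._< paletteSize (degℓ Q R v)) (sym (trans (length-map g (elements W)) (length-elements W)))
               (palette> (degℓ Q R v)))
      x : ℕ
      x = proj₁ fresh
      c : Fin n → ℕ
      c u = if does (u ≟ v) then x else 1
      c-v : c v ≡ x
      c-v rewrite dec-true (v ≟ v) refl = refl
      c-other : ∀ {u} → u ≢ v → c u ≡ 1
      c-other {u} u≢v rewrite dec-false (u ≟ v) u≢v = refl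
      admissible : ∀ u → u ∈ U → 1 ℕ.≤ c u × c u ℕ.≤ paletteSize (degℓ Q R u)
      admissible u u∈U with u ≟ v
      ... | yes refl = proj₁ (proj₂ fresh) , proj₁ (proj₂ (proj₂ fresh))
      ... | no _     = s≤s z≤n , ℕ.≤-trans (s≤s z≤n) (palette> (degℓ Q R u))
      g∈forbidden : ∀ {u} → u ∈ W → g u ∈ᴸ forbidden
      g∈forbidden u∈W = ∈-map⁺ g (∈-elements⁺ u∈W)
      x≢g : ∀ {u} → u ∈ W → x ≢ g u
      x≢g u∈W x≡gu = proj₂ (proj₂ (proj₂ fresh)) (subst (_∈ᴸ forbidden) (sym x≡gu) (g∈forbidden u∈W))
      open Resolve U C B c
      noConflict : NoConflict v
      noConflict = distinct , allowed
        where
        distinct : ∀ {u} → u ∈ N v ∩ U → c u ≢ c v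
        distinct {u} u∈ eq with u∈N , u∈U ← x∈p∩q⁻ (N v) U u∈ =
          x≢g (x∈p∩q⁺ (u∈N , q⊆p∪q Q R (U⊆R u∈U))) (begin
            x    ≡⟨ c-v ⟨
            c v  ≡⟨ eq ⟨
            c u  ≡⟨ c-other {u} (λ { refl → N-irrefl u∈N }) ⟩
            1    ≡⟨ cong (if_then 1 else C u) (dec-true (u ∈? U) u∈U) ⟨
            g u  ∎)
          where open ≡-Reasoning
        allowed : c v ∉ᴸ B v
        -- By `sound`, a forbidden color belongs to a neighbor outside `U`, where `g` agrees with
        -- `C`.
        allowed cv∈B with u , u∈W , u∉U , eq ← sound cv∈B =
          x≢g u∈W (trans (sym c-v) (trans eq
            (cong (if_then 1 else C u) (sym (dec-false (u ∈? U) u∉U)))))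
      v∉U′ : v ∉ U′
      v∉U′ v∈U′ with eq ← trans (sym (proj₂ (∈-uncolored⁻ v∈U′))) (trans (resolve-noConflict v∈U noConflict) c-v)
        = ℕ.<⇒≢ (proj₁ (proj₂ fresh)) eq

    -- Lexicographic induction on the pending parts and then on `∣ U ∣`: `advance` consumes a part
    -- and may therefore restart the size at `∣ R′ ∣`.
    finish : ∀ {s} → Invariant s → ∃[ t ] s ⟶* t × Finished t
    finish {⟨ P , Q , R , U , C , B ⟩} inv = go P Q R U C B inv (<-wellFounded ∣ U ∣)
      where
      go : ∀ P Q R U C B → Invariant ⟨ P , Q , R , U , C , B ⟩ → Acc ℕ._<_ ∣ U ∣ →
           ∃[ t ] ⟨ P , Q , R , U , C , B ⟩ ⟶* t × Finished t
      go P Q R U C B inv (acc rec) with nonempty? U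
      ... | yes nonempty
        with U′ , C′ , B′ , smaller , st ← progress P Q R U C B nonempty inv
        with t , sts , fin ← go P Q R U′ C′ B′ (step-invariant st inv) (rec smaller)
        = t , st ◅ sts , fin
      go []       Q R U C B inv (acc rec) | no empty = _ , ε* , refl , empty
      go (R′ ∷ P) Q R U C B inv (acc rec) | no empty
        with t , sts , fin ← go P (Q ∪ R) R′ R′ C _ (step-invariant (advance empty) inv) (<-wellFounded ∣ R′ ∣)
        = t , advance empty ◅ sts , fin

-- From an ADG run to a schedule within the color bound

module _ {c ℓ₁ ℓ₂} (K : ArchimedeanOrderedField c ℓ₁ ℓ₂) {n : ℕ} (G : Graph n) {d : ℕ}
         (degenerate : HasDegeneracyBound G d)
         {ε : ArchimedeanOrderedField.Carrier K}
         (0<ε : ArchimedeanOrderedField._<_ K (ArchimedeanOrderedField.0# K) ε)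
         (ε≤8 : ArchimedeanOrderedField._≤_ K ε (ArchimedeanOrderedField.⟦_⟧ K 8))
         {k₀ : ℕ} (k₀≤d : k₀ ℕ.≤ d) where
  open ArchimedeanOrderedField K using (1#; ⟦_⟧; _*_; _+_; _≤_)
  open OrderedFieldProperties.Accuracy K 0<ε ε≤8
  open Graph G
  open ADG K G η using (Loop; stop; iter; select)
  open ADGProperties K G η 0≤η
  open DecADG K G ε k₀ using (paletteSize)
  open DecADGProperties K G ε k₀ (bound d)

  paletteSize≤ : ∀ m → ⟦ m ⟧ ≤ ((1# + η) * ⟦ 2 ℕ.* d ⟧) → paletteSize m ℕ.≤ bound d
  paletteSize≤ zero    _  = ℕ.≤-trans k₀≤d (d≤bound d)
  paletteSize≤ (suc m) m≤ = ⌈[1+μ]⌉≤bound d (suc m) m≤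

  paletteSize> : 1 ℕ.≤ k₀ → ∀ m → suc m ℕ.≤ paletteSize m
  paletteSize> 1≤k₀ zero    = 1≤k₀
  paletteSize> 1≤k₀ (suc m) = suc-≤⌈[1+μ]⌉ (suc m) (s≤s z≤n)

  -- foldl (flip _∷_) P Rs is reverse Rs ++ P.
  loop-schedule : ∀ {U D Rs P} → DegreesIn U D → Loop U D Rs → Schedule U P →
                  Schedule ∅ (foldl (flip _∷_) P Rs)
  loop-schedule {P = P} degrees (stop empty) schedule =
    -- The loop has emptied `U`, so the accumulated schedule starts from the empty set, as `initial`
    -- requires.
    subst (λ A → Schedule A P) (Empty-unique empty) schedule
  loop-schedule {U} {D} degrees (iter nonempty loop) schedule =
    loop-schedule (decrement-degrees (select⊆ U D) degrees) loop
      (next (λ v∈R v∈U─R → ∈-─⁻ U R v∈U─R v∈R)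
            (λ {v} v∈R → subst (λ A → paletteSize ∣ N v ∩ A ∣ ℕ.≤ bound d) (sym rejoin)
                              (paletteSize≤ ∣ N v ∩ U ∣ (select-degree degenerate nonempty degrees v∈R)))
            (subst (λ A → Schedule A _) (sym rejoin) schedule))
    where
    R : Subset n
    R = select U D
    rejoin : (U ─ R) ∪ R ≡ U
    rejoin = ⊆-antisym
      (λ v∈ → [ p─q⊆p U R , select⊆ U D ] (x∈p∪q⁻ (U ─ R) R v∈))
      λ {v} v∈U → x∈p∪q⁺ (case v ∈? R of λ
        { (yes v∈R) → inj₂ v∈R
        ; (no v∉R)  → inj₁ (x∈p∧x∉q⇒x∈p─q v∈U v∉R) })

  run-schedule : ∀ {Rs} → ADG.Run K G η Rs → Schedule ∅ (reverse Rs)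
  -- The accumulator begins at the far end: with `U = ⊤` all vertices are covered and no part
  -- remains to be scheduled.
  run-schedule run = loop-schedule (λ {u} _ → cong ∣_∣ (sym (∩-identityʳ (N u)))) run (done λ _ → ∈⊤)

-- The existence of an ADG run and, for 1 ≤ k₀, of a finishing continuation from every reachable
-- state keep the statement about finished states from being vacuous.
claim2 : ∀ {c ℓ₁ ℓ₂ : Level} (K : ArchimedeanOrderedField c ℓ₁ ℓ₂) →
    let open ArchimedeanOrderedField K in
    {n : ℕ} (G : Graph n) (d : ℕ) → IsDegeneracy G d →
    (ε : Carrier) → 0# < ε → ε ≤ ⟦ 8 ⟧ →
    (k₀ : ℕ) → k₀ ℕ.≤ d →
    let open DecADG K G ε k₀ in
    (∃[ Rs ] ADG.Run K G η Rs) ×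
    (∀ Rs → ADG.Run K G η Rs → ∀ s → initial Rs ⟶* s →
    (1 ℕ.≤ k₀ → ∃[ t ] s ⟶* t × Finished t) ×
    (Finished s →
    IsColoring G (State.C s) ×
    numColors (State.C s) ℕ.≤ ⌈ (⟦ 2 ⟧ + ε) * ⟦ d ⟧ ⌉))
claim2 K G d (degenerate , _) ε 0<ε ε≤8 k₀ k₀≤d =
  ADGProperties.loop-terminates K G η 0≤η _ _ ,
  λ Rs run s steps →
    let inv = steps-invariant steps (initial-invariant {Rs} (run-schedule K G degenerate 0<ε ε≤8 k₀≤d run)) in
    (λ 1≤k₀ → Progress.finish (paletteSize> K G degenerate 0<ε ε≤8 k₀≤d 1≤k₀) inv) ,
    λ fin → finished-coloring fin inv , numColors≤ (State.C s) (finished-colored fin inv)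
  where
  open OrderedFieldProperties.Accuracy K 0<ε ε≤8
  open DecADG K G ε k₀ using (module State)
  open DecADGProperties K G ε k₀ (bound d)
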